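{- For every integer $t \geq 1$, there exists a connected non-bipartite graph whose adjacency matrix has exactly five distinct eigenvalues and which has exactly $t$ distinct valencies (vertex degrees).
   Context: Eigenvalues of a graph are the eigenvalues of its adjacency matrix. Graphs are finite, simple and undirected. -}

module Defs where

open import Algebra.Bundles.Raw using (RawMonoid)
open import Algebra.Bundles using (module CommutativeMonoid)
import Algebra.Definitions.RawMonoid as RawMonoidDefs
import Algebra.Properties.AbelianGroup as AbelianGroupProperties
import Algebra.Properties.CommutativeSemigroup as CommutativeSemigroupProperties
import Algebra.Properties.Ring as RingProperties
open import Data.Bool.Base using (Bool; if_then_else_)
open import Data.Fin.Base using (Fin)
open import Data.List.Base using (allFin; filter; length)
open import Data.Nat.Base as ℕ using (ℕ; _⊔_)
import Data.Nat.Properties as ℕ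
open import Data.Product.Base using (Σ-syntax; ∃-syntax; _×_; _,_)
open import Data.Rational.Base as ℚ using (ℚ; 0ℚ; 1ℚ; ½; ∣_∣; 1/_)
import Data.Rational.Properties as ℚ
open import Data.Vec.Functional using (Vector)
open import Function.Definitions using (Injective)
open import Level using (0ℓ)
open import Relation.Binary.Construct.Closure.ReflexiveTransitive using (Star)
open import Relation.Binary.Core using (Rel)
open import Relation.Binary.Definitions using (Decidable; Irreflexive; Symmetric)
open import Relation.Binary.PropositionalEquality
  using (_≡_; _≢_; refl; sym; trans; cong; cong₂; subst; module ≡-Reasoning)
open import Relation.Nullary.Decidable.Core using (does)
open import Relation.Nullary.Negation.Core using (¬_)
open import Relation.Unary using (Pred)

------------------------------------------------------------------------
-- Real numbers

-- The standard library has no real numbers.  Here they are Cauchy sequences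
-- of rationals, compared by the setoid equality _≈_ rather than by _≡_.

IsCauchy : (ℕ → ℚ) → Set
IsCauchy x = ∀ ε → 0ℚ ℚ.< ε →
  ∃[ N ] (∀ m n → N ℕ.≤ m → N ℕ.≤ n → ∣ x m ℚ.- x n ∣ ℚ.< ε)

record ℝ : Set where
  constructor mkℝ
  field
    seq    : ℕ → ℚ
    cauchy : IsCauchy seq

open ℝ public

infix 4 _≈_

_≈_ : Rel ℝ 0ℓ
x ≈ y = ∀ ε → 0ℚ ℚ.< ε →
  ∃[ N ] (∀ n → N ℕ.≤ n → ∣ seq x n ℚ.- seq y n ∣ ℚ.< ε)

fromℚ : ℚ → ℝ
fromℚ q = mkℝ (λ _ → q) λ ε 0<ε →
  0 , λ _ _ _ _ → subst (λ p → ∣ p ∣ ℚ.< ε) (sym (ℚ.+-inverseʳ q)) 0<ε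

0ℝ 1ℝ : ℝ
0ℝ = fromℚ 0ℚ
1ℝ = fromℚ 1ℚ

½ε>0 : ∀ {ε} → 0ℚ ℚ.< ε → 0ℚ ℚ.< ½ ℚ.* ε
½ε>0 {ε} 0<ε =
  ℚ.positive⁻¹ _ {{ℚ.pos*pos⇒pos ½ ε {{ℚ.positive 0<ε}}}}

½ε+½ε≡ε : ∀ ε → ½ ℚ.* ε ℚ.+ ½ ℚ.* ε ≡ ε
½ε+½ε≡ε ε = trans (sym (ℚ.*-distribʳ-+ ε ½ ½)) (ℚ.*-identityˡ ε)

module ℚ⁺ = AbelianGroupProperties ℚ.+-0-abelianGroup
module ℚᵣ = RingProperties ℚ.+-*-ring
open CommutativeSemigroupProperties
  (CommutativeMonoid.commutativeSemigroup ℚ.+-0-commutativeMonoid) using (interchange)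

+-split : ∀ a b c d → (a ℚ.+ b) ℚ.- (c ℚ.+ d) ≡ (a ℚ.- c) ℚ.+ (b ℚ.- d)
+-split a b c d = trans (cong (a ℚ.+ b ℚ.+_) (ℚ.neg-distrib-+ c d))
                        (interchange a b (ℚ.- c) (ℚ.- d))

telescope : ∀ p q r → (p ℚ.- q) ℚ.+ (q ℚ.- r) ≡ p ℚ.- r
telescope p q r = trans (ℚ.+-assoc p (ℚ.- q) (q ℚ.- r))
                        (cong (p ℚ.+_) (ℚ⁺.\\-leftDividesʳ q (ℚ.- r)))

*-split : ∀ a b c d →
  (a ℚ.* b) ℚ.- (c ℚ.* d) ≡ a ℚ.* (b ℚ.- d) ℚ.+ d ℚ.* (a ℚ.- c)
*-split a b c d = begin
  a ℚ.* b ℚ.- c ℚ.* d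
    ≡⟨ telescope (a ℚ.* b) (a ℚ.* d) (c ℚ.* d) ⟨
  (a ℚ.* b ℚ.- a ℚ.* d) ℚ.+ (a ℚ.* d ℚ.- c ℚ.* d)
    ≡⟨ cong₂ ℚ._+_ (ℚᵣ.x[y-z]≈xy-xz a b d) (ℚᵣ.[y-z]x≈yx-zx d a c) ⟨
  a ℚ.* (b ℚ.- d) ℚ.+ (a ℚ.- c) ℚ.* d
    ≡⟨ cong (a ℚ.* (b ℚ.- d) ℚ.+_) (ℚ.*-comm (a ℚ.- c) d) ⟩
  a ℚ.* (b ℚ.- d) ℚ.+ d ℚ.* (a ℚ.- c)
    ∎
  where open ≡-Reasoning

bounded : ∀ {x} → IsCauchy x →
  Σ[ K ∈ ℚ ] ℚ.Positive K × ∃[ N ] (∀ n → N ℕ.≤ n → ∣ x n ∣ ℚ.≤ K)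
bounded {x} cx with cx 1ℚ (ℚ.positive⁻¹ 1ℚ)
... | N , close =
  ∣ x N ∣ ℚ.+ 1ℚ
  , ℚ.nonNeg+pos⇒pos ∣ x N ∣ {{ℚ.∣-∣-nonNeg (x N)}} 1ℚ
  , N , λ n N≤n → begin
    ∣ x n ∣                         ≡⟨ cong ∣_∣ (regroup (x n) (x N)) ⟩
    ∣ x N ℚ.+ (x n ℚ.- x N) ∣       ≤⟨ ℚ.∣p+q∣≤∣p∣+∣q∣ (x N) _ ⟩
    ∣ x N ∣ ℚ.+ ∣ x n ℚ.- x N ∣     ≤⟨ ℚ.+-monoʳ-≤ ∣ x N ∣
                                        (ℚ.<⇒≤ (close n N N≤n ℕ.≤-refl)) ⟩
    ∣ x N ∣ ℚ.+ 1ℚ                  ∎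
  where
  open ℚ.≤-Reasoning
  regroup : ∀ a b → a ≡ b ℚ.+ (a ℚ.- b)
  regroup a b = trans (sym (ℚ⁺.xyx⁻¹≈y b a)) (ℚ.+-assoc b a (ℚ.- b))

_/⁺_ : ℚ → (K : ℚ) .{{_ : ℚ.Positive K}} → ℚ
ε /⁺ K = (1/ K) {{ℚ.pos⇒nonZero K}} ℚ.* ε

/⁺>0 : ∀ K {{_ : ℚ.Positive K}} {ε} → 0ℚ ℚ.< ε → 0ℚ ℚ.< ε /⁺ K
/⁺>0 K {ε} 0<ε = ℚ.positive⁻¹ _
  {{ℚ.pos*pos⇒pos ((1/ K) {{ℚ.pos⇒nonZero K}}) {{ℚ.1/pos⇒pos K}}
                  ε {{ℚ.positive 0<ε}}}}

product-small : ∀ K {{_ : ℚ.Positive K}} a d ε → ∣ a ∣ ℚ.≤ K →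
  ∣ d ∣ ℚ.< ε /⁺ K → ∣ a ℚ.* d ∣ ℚ.< ε
product-small K a d ε a≤K d<ε/K = begin-strict
  ∣ a ℚ.* d ∣             ≡⟨ ℚ.∣p*q∣≡∣p∣*∣q∣ a d ⟩
  ∣ a ∣ ℚ.* ∣ d ∣         ≤⟨ ℚ.*-monoʳ-≤-nonNeg ∣ d ∣ {{ℚ.∣-∣-nonNeg d}} a≤K ⟩
  K ℚ.* ∣ d ∣             <⟨ ℚ.*-monoʳ-<-pos K d<ε/K ⟩
  K ℚ.* (1/ K ℚ.* ε)      ≡⟨ ℚ.*-assoc K (1/ K) ε ⟨
  (K ℚ.* 1/ K) ℚ.* ε      ≡⟨ cong (ℚ._* ε) (ℚ.*-inverseʳ K) ⟩
  1ℚ ℚ.* ε                ≡⟨ ℚ.*-identityˡ ε ⟩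
  ε                       ∎
  where
  open ℚ.≤-Reasoning
  instance K≢0 = ℚ.pos⇒nonZero K

sum-small : ∀ a b ε → ∣ a ∣ ℚ.< ½ ℚ.* ε → ∣ b ∣ ℚ.< ½ ℚ.* ε →
  ∣ a ℚ.+ b ∣ ℚ.< ε
sum-small a b ε a< b< = begin-strict
  ∣ a ℚ.+ b ∣             ≤⟨ ℚ.∣p+q∣≤∣p∣+∣q∣ a b ⟩
  ∣ a ∣ ℚ.+ ∣ b ∣         <⟨ ℚ.+-mono-< a< b< ⟩
  ½ ℚ.* ε ℚ.+ ½ ℚ.* ε     ≡⟨ ½ε+½ε≡ε ε ⟩
  ε                       ∎
  where open ℚ.≤-Reasoning

abstract

  +-cauchy : ∀ x y → IsCauchy x → IsCauchy y → IsCauchy (λ n → x n ℚ.+ y n)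
  +-cauchy x y cx cy ε 0<ε
    with cx (½ ℚ.* ε) (½ε>0 0<ε) | cy (½ ℚ.* ε) (½ε>0 0<ε)
  ... | M , x-close | N , y-close = M ⊔ N , λ m n ≤m ≤n →
    subst (λ p → ∣ p ∣ ℚ.< ε) (sym (+-split (x m) (y m) (x n) (y n)))
      (sum-small (x m ℚ.- x n) (y m ℚ.- y n) ε
        (x-close m n (ℕ.m⊔n≤o⇒m≤o M N ≤m) (ℕ.m⊔n≤o⇒m≤o M N ≤n))
        (y-close m n (ℕ.m⊔n≤o⇒n≤o M N ≤m) (ℕ.m⊔n≤o⇒n≤o M N ≤n)))

  *-cauchy : ∀ x y → IsCauchy x → IsCauchy y → IsCauchy (λ n → x n ℚ.* y n)
  *-cauchy x y cx cy ε 0<ε =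
    let K , K>0 , M₁ , x≤K = bounded cx
        L , L>0 , N₁ , y≤L = bounded cy
        M₂ , x-close = cx (((½ ℚ.* ε) /⁺ L) {{L>0}}) (/⁺>0 L {{L>0}} (½ε>0 0<ε))
        N₂ , y-close = cy (((½ ℚ.* ε) /⁺ K) {{K>0}}) (/⁺>0 K {{K>0}} (½ε>0 0<ε))
    in (M₁ ⊔ N₁) ⊔ (M₂ ⊔ N₂) , λ m n ≤m ≤n →
      let ≤m₁ = ℕ.m⊔n≤o⇒m≤o (M₁ ⊔ N₁) (M₂ ⊔ N₂) ≤m
          ≤n₁ = ℕ.m⊔n≤o⇒m≤o (M₁ ⊔ N₁) (M₂ ⊔ N₂) ≤n
          ≤m₂ = ℕ.m⊔n≤o⇒n≤o (M₁ ⊔ N₁) (M₂ ⊔ N₂) ≤m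
          ≤n₂ = ℕ.m⊔n≤o⇒n≤o (M₁ ⊔ N₁) (M₂ ⊔ N₂) ≤n
      in subst (λ p → ∣ p ∣ ℚ.< ε) (sym (*-split (x m) (y m) (x n) (y n)))
        (sum-small (x m ℚ.* (y m ℚ.- y n)) (y n ℚ.* (x m ℚ.- x n)) ε
          (product-small K {{K>0}} (x m) (y m ℚ.- y n) (½ ℚ.* ε)
            (x≤K m (ℕ.m⊔n≤o⇒m≤o M₁ N₁ ≤m₁))
            (y-close m n (ℕ.m⊔n≤o⇒n≤o M₂ N₂ ≤m₂) (ℕ.m⊔n≤o⇒n≤o M₂ N₂ ≤n₂)))
          (product-small L {{L>0}} (y n) (x m ℚ.- x n) (½ ℚ.* ε)
            (y≤L n (ℕ.m⊔n≤o⇒n≤o M₁ N₁ ≤n₁))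
            (x-close m n (ℕ.m⊔n≤o⇒m≤o M₂ N₂ ≤m₂) (ℕ.m⊔n≤o⇒m≤o M₂ N₂ ≤n₂))))

infixl 6 _+_
infixl 7 _*_

_+_ : ℝ → ℝ → ℝ
x + y = mkℝ (λ n → seq x n ℚ.+ seq y n) (+-cauchy (seq x) (seq y) (cauchy x) (cauchy y))

_*_ : ℝ → ℝ → ℝ
x * y = mkℝ (λ n → seq x n ℚ.* seq y n) (*-cauchy (seq x) (seq y) (cauchy x) (cauchy y))

+-0-rawMonoid : RawMonoid 0ℓ 0ℓ
+-0-rawMonoid = record { Carrier = ℝ ; _≈_ = _≈_ ; _∙_ = _+_ ; ε = 0ℝ }

open RawMonoidDefs +-0-rawMonoid public using (sum)

------------------------------------------------------------------------
-- Real matrices and eigenvalues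

Matrix : ℕ → Set
Matrix n = Fin n → Fin n → ℝ

infixr 7 _*ᵥ_ _·_

_*ᵥ_ : ∀ {n} → Matrix n → Vector ℝ n → Vector ℝ n
(A *ᵥ v) i = sum (λ j → A i j * v j)

_·_ : ∀ {n} → ℝ → Vector ℝ n → Vector ℝ n
(μ · v) i = μ * v i

IsEigenvalue : ∀ {n} → Matrix n → ℝ → Set
IsEigenvalue {n} A μ = Σ[ v ∈ Vector ℝ n ]
  ¬ (∀ i → v i ≈ 0ℝ) × (∀ i → (A *ᵥ v) i ≈ (μ · v) i)

------------------------------------------------------------------------
-- Counting up to a given equality

-- Exactly k elements satisfy P, where ∼-related elements count once.
Exactly : ∀ {A : Set} → ℕ → Rel A 0ℓ → Pred A 0ℓ → Set
Exactly {A} k _∼_ P = Σ[ f ∈ (Fin k → A) ]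
  Injective _≡_ _∼_ f × (∀ i → P (f i)) × (∀ a → P a → ∃[ i ] a ∼ f i)

------------------------------------------------------------------------
-- Finite simple undirected graphs

record Graph (n : ℕ) : Set₁ where
  infix 4 _~_ _~?_
  field
    _~_    : Rel (Fin n) 0ℓ
    _~?_   : Decidable _~_
    ~-sym  : Symmetric _~_
    ~-irr  : Irreflexive _≡_ _~_

  adjacencyMatrix : Matrix n
  adjacencyMatrix i j = if does (i ~? j) then 1ℝ else 0ℝ

  degree : Fin n → ℕ
  degree i = length (filter (i ~?_) (allFin n))

  IsValency : Pred ℕ 0ℓ
  IsValency d = ∃[ i ] degree i ≡ d

  Connected : Set
  Connected = ∀ i j → Star _~_ i j

  Bipartite : Set
  Bipartite = Σ[ colour ∈ (Fin n → Bool) ] (∀ {i j} → i ~ j → colour i ≢ colour j)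

{-# OPTIONS --safe #-}
module Submission where

open import Algebra.Bundles using (CommutativeMonoid; CommutativeRing)
import Algebra.Properties.CommutativeMonoid.Sum as MonoidSum
import Algebra.Properties.Group as GroupProperties
import Algebra.Properties.Semiring.Sum as SemiringSum
import Algebra.Solver.Ring as RingSolver
open import Algebra.Solver.Ring.AlmostCommutativeRing
  using (fromCommutativeRing; _-Raw-AlmostCommutative⟶_)
open import Algebra.Structures using (IsCommutativeRing)
open import Data.Bool.Base using (Bool; true; false; if_then_else_; not; _∧_; _∨_; T)
import Data.Bool.Properties as Bool
open import Data.Empty using (⊥-elim)
open import Data.Fin.Base using (Fin; zero; suc; toℕ; fromℕ<; splitAt; _↑ˡ_; _↑ʳ_)
open import Data.Fin.Patterns using (0F; 1F; 2F; 3F; 4F)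
open import Data.Fin.Properties as Fin
  using (_≟_; all?; any?; splitAt-↑ˡ; splitAt-↑ʳ; join-splitAt)
open import Data.Fin.Subset using (Subset; inside; outside; ⊤; ⊥; ⁅_⁆) renaming (∣_∣ to card)
open import Data.Fin.Subset.Properties using (∣⊥∣≡0; ∣p∣≤n)
open import Data.Integer.Base as ℤ using (ℤ; 0ℤ; 1ℤ; -1ℤ; +_; -[1+_])
import Data.Integer.Properties as ℤ
import Data.Integer.Solver as ℤSolver
open import Data.List.Base as List using (List; []; _∷_; _++_; length; filter; allFin)
open import Data.List.Membership.Propositional using (_∈_)
open import Data.List.Membership.Propositional.Properties using (∈-++⁺ˡ; ∈-++⁺ʳ; ∈-map⁺; ∈-lookup)
open import Data.List.Relation.Unary.All as All using (All; []; _∷_)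
import Data.List.Relation.Unary.All.Properties as All
open import Data.List.Relation.Unary.Any as Any using (here; there)
import Data.List.Relation.Unary.Any.Properties as Any
open import Data.Maybe.Base as Maybe using ()
open import Data.Nat.Base as ℕ
  using (ℕ; zero; suc; _≤_; _<_; _≥_; _⊔_; _≡ᵇ_; z≤n; s≤s; s<s⁻¹)
import Data.Nat.Coprimality as Coprimality
import Data.Nat.Properties as ℕ
open import Data.Nat.Solver using (module +-*-Solver)
open import Data.Product.Base using (Σ-syntax; ∃-syntax; _×_; _,_)
open import Data.Rational.Base as ℚ using (ℚ; mkℚ; 0ℚ; ½; ∣_∣)
import Data.Rational.Properties as ℚ
import Data.Rational.Unnormalised.Base as ℚᵘ
import Data.Rational.Unnormalised.Properties as ℚᵘ
open import Data.Sum.Base using (_⊎_; inj₁; inj₂; [_,_]′)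
open import Data.Unit.Base using (tt)
open import Data.Vec.Base as Vec using (Vec; []; _∷_; tabulate; lookup)
open import Data.Vec.Properties using (lookup∘tabulate; lookup-replicate; ≡-dec)
open import Data.Vec.Relation.Unary.All using ([]; _∷_)
open import Data.Vec.Relation.Unary.AllPairs using ([]; _∷_)
open import Data.Vec.Relation.Unary.Unique.Propositional.Properties using (lookup-injective)
open import Function.Base using (_∘_; id)
open import Function.Definitions using (Injective)
open import Level using (0ℓ)
open import Relation.Binary.Construct.Closure.ReflexiveTransitive as Star using (Star; _◅_; _◅◅_)
open import Relation.Binary.PropositionalEquality as ≡ using (_≡_; _≢_)
open import Relation.Nullary.Decidable
  using (Dec; does; yes; no; T?; ¬?; _×-dec_; _→-dec_; from-yes; dec-true; dec-false; dec⇒maybe)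
open import Relation.Nullary.Negation.Core using (¬_; contradiction)

-- For t ≥ 3 put v = t - 1 and take a clique on v points together with a family of blocks,
-- subsets of the points, where each block is a further vertex adjacent to its points and
-- repeated blocks are allowed.  Suppose that each point is in r blocks and each pair of points
-- in λ blocks, and write N for the incidence matrix, so that N Nᵀ = (r - λ) I + λ J.  Let
-- (x , y) be an eigenvector for μ with σ the sum of x.  The block rows say Nᵀ x = μ y, and
-- eliminating y from the point rows gives
--   (μ² + μ - (r - λ)) x = (μ + λ) σ 1,
-- whence (μ² - (v - 1) μ - (r - λ) - v λ) σ = 0 by summation.  So there are at most five
-- eigenvalues: 0 and the roots of two quadratics.  With all nonempty subsets as blocks the
-- valencies of the blocks are 1, …, v, and repeating singletons and the full set adjusts
-- r - λ and λ so that the roots become integers.  For t ≤ 2 two explicit graphs with integer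
-- eigenvalues θᵢ serve, for which ∏ (A - θᵢ) = 0 is verified by computation.
--
-- Integer eigenvalues make the argument constructive: a real μ is bounded away from all but one
-- of five given integers, and if it annihilates a nonvanishing vector through the product of the
-- differences, it equals the remaining one, because x ≈ 0 is stable under double negation.

-- Splitting finite index sets, and the clique with blocks.

splitAt-elim : ∀ m {n} (P : Fin (m ℕ.+ n) → Set) →
  (∀ i → P (i ↑ˡ n)) → (∀ j → P (m ↑ʳ j)) → ∀ i → P i
splitAt-elim m {n} P left right i with splitAt m i | join-splitAt m n i
... | inj₁ j | eq = ≡.subst P eq (left j)
... | inj₂ k | eq = ≡.subst P eq (right k)

module _ {a ℓ} (M : CommutativeMonoid a ℓ) where
  open CommutativeMonoid M
  open MonoidSum M using (sum)

  sum-splitAt : ∀ m {n} (f : Fin (m ℕ.+ n) → Carrier) →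
    sum f ≈ sum (λ i → f (i ↑ˡ n)) ∙ sum (λ j → f (m ↑ʳ j))
  sum-splitAt ℕ.zero    f = sym (identityˡ _)
  sum-splitAt (ℕ.suc m) f =
    trans (∙-congˡ (sum-splitAt m (f ∘ suc))) (sym (assoc _ _ _))

cliqueWithBlocks⊎ : ∀ {v b} → (Fin b → Fin v → Bool) → Fin v ⊎ Fin b → Fin v ⊎ Fin b → Bool
cliqueWithBlocks⊎ mem (inj₁ i) (inj₁ j) = not (does (i ≟ j))
cliqueWithBlocks⊎ mem (inj₁ i) (inj₂ k) = mem k i
cliqueWithBlocks⊎ mem (inj₂ k) (inj₁ i) = mem k i
cliqueWithBlocks⊎ mem (inj₂ k) (inj₂ l) = false

cliqueWithBlocks : ∀ {v b} → (Fin b → Fin v → Bool) → Fin (v ℕ.+ b) → Fin (v ℕ.+ b) → Bool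
cliqueWithBlocks {v} mem i j = cliqueWithBlocks⊎ mem (splitAt v i) (splitAt v j)

module ℕΣ = SemiringSum ℕ.+-*-semiring
module ℤΣ = SemiringSum ℤ.+-*-semiring

𝟙ℕ : Bool → ℕ
𝟙ℕ b = if b then 1 else 0

𝟙ℤ : Bool → ℤ
𝟙ℤ b = if b then 1ℤ else 0ℤ

-- If w is an eigenvector for μ then ⟨ shift t z , w ⟩ = (μ - t) ⟨ z , w ⟩, so a product of shifts
-- that kills the standard basis annihilates every eigenvector.  The integer vectors are of type
-- Vec, not functions, so that an iterated shift is evaluated only once per entry.
basis : ∀ {n} → Fin n → Vec ℤ n
basis i = tabulate λ j → 𝟙ℤ (does (i ≟ j))

shift : ∀ {n} → (Fin n → Fin n → Bool) → ℤ → Vec ℤ n → Vec ℤ n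
shift adj t z = tabulate λ i →
  ℤΣ.sum (λ j → 𝟙ℤ (adj j i) ℤ.* lookup z j) ℤ.- t ℤ.* lookup z i

shifts : ∀ {k n} → (Fin n → Fin n → Bool) → (Fin k → ℤ) → Vec ℤ n → Vec ℤ n
shifts {ℕ.zero}  adj θ z = z
shifts {ℕ.suc k} adj θ z = shift adj (θ zero) (shifts adj (θ ∘ suc) z)

module _ {v b} (mem : Fin b → Fin v → Bool) where

  adj-↑ˡ-↑ˡ : ∀ i j → cliqueWithBlocks mem (i ↑ˡ b) (j ↑ˡ b) ≡ not (does (i ≟ j))
  adj-↑ˡ-↑ˡ i j = ≡.cong₂ (cliqueWithBlocks⊎ mem) (splitAt-↑ˡ v i b) (splitAt-↑ˡ v j b)

  adj-↑ˡ-↑ʳ : ∀ i k → cliqueWithBlocks mem (i ↑ˡ b) (v ↑ʳ k) ≡ mem k i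
  adj-↑ˡ-↑ʳ i k = ≡.cong₂ (cliqueWithBlocks⊎ mem) (splitAt-↑ˡ v i b) (splitAt-↑ʳ v b k)

  adj-↑ʳ-↑ˡ : ∀ k j → cliqueWithBlocks mem (v ↑ʳ k) (j ↑ˡ b) ≡ mem k j
  adj-↑ʳ-↑ˡ k j = ≡.cong₂ (cliqueWithBlocks⊎ mem) (splitAt-↑ʳ v b k) (splitAt-↑ˡ v j b)

  adj-↑ʳ-↑ʳ : ∀ k l → cliqueWithBlocks mem (v ↑ʳ k) (v ↑ʳ l) ≡ false
  adj-↑ʳ-↑ʳ k l = ≡.cong₂ (cliqueWithBlocks⊎ mem) (splitAt-↑ʳ v b k) (splitAt-↑ʳ v b l)

spectrum : (t₁ t₂ a₁ a₂ : ℤ) → Fin 5 → ℤ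
spectrum t₁ t₂ a₁ a₂ = lookup (0ℤ ∷ t₁ ∷ t₂ ∷ a₁ ∷ a₂ ∷ [])

-- Eigenvector algebra over a commutative ring with a homomorphism from ℤ.

module SpectralAlgebra
  (R : CommutativeRing 0ℓ 0ℓ)
  (ℤ⟶R : ℤ.+-*-rawRing -Raw-AlmostCommutative⟶ fromCommutativeRing R)
  where

  open CommutativeRing R hiding (zero)
  open _-Raw-AlmostCommutative⟶_ ℤ⟶R public
  open SemiringSum semiring
  open import Relation.Binary.Reasoning.Setoid setoid
  open RingSolver ℤ.+-*-rawRing (fromCommutativeRing R) ℤ⟶R
    (λ i j → Maybe.map (reflexive ∘ ≡.cong ⟦_⟧) (dec⇒maybe (i ℤ.≟ j)))
    using (solve; _:=_; con; _:+_; _:*_; _:-_; :-_)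

  𝟙 : Bool → Carrier
  𝟙 b = if b then 1# else 0#

  IsEigenvector : ∀ {n} → (Fin n → Fin n → Bool) → Carrier → (Fin n → Carrier) → Set
  IsEigenvector adj μ w = ∀ i → sum (λ j → 𝟙 (adj i j) * w j) ≈ μ * w i

  -- The product is nested as an action on `y` so that later its factors can be cancelled one at a
  -- time from the outside.
  factors : ∀ {k} → (Fin k → ℤ) → Carrier → Carrier → Carrier
  factors {ℕ.zero}  θ μ y = y
  factors {ℕ.suc k} θ μ y = (μ - ⟦ θ zero ⟧) * factors (θ ∘ suc) μ y

  factors-cong : ∀ {k} (θ : Fin k → ℤ) μ {y z} → y ≈ z → factors θ μ y ≈ factors θ μ z
  factors-cong {ℕ.zero}  θ μ y≈z = y≈z
  factors-cong {ℕ.suc k} θ μ y≈z = *-congˡ (factors-cong (θ ∘ suc) μ y≈z)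

  -- A division-free form of the claim that every eigenvalue is among the `θ i`. It concerns each
  -- coordinate separately; that some coordinate does not vanish enters only in `root-of-factors`.
  Annihilates : ∀ {k n} → (Fin k → ℤ) → (Fin n → Fin n → Bool) → Set
  Annihilates θ adj = ∀ μ w → IsEigenvector adj μ w → ∀ i → factors θ μ (w i) ≈ 0#

  sum-0 : ∀ {n} (f : Fin n → Carrier) → (∀ i → f i ≈ 0#) → sum f ≈ 0#
  sum-0 {n} f f≈0 = trans (sum-cong-≋ f≈0) (sum-replicate-zero n)

  sum-const : ∀ n x → sum {n} (λ _ → x) ≈ ⟦ + n ⟧ * x
  sum-const ℕ.zero    x = sym (trans (*-congʳ 0-homo) (zeroˡ x))
  sum-const (ℕ.suc n) x = begin
    x + sum {n} (λ _ → x)          ≈⟨ +-congˡ (sum-const n x) ⟩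
    x + ⟦ + n ⟧ * x                ≈⟨ solve 2 (λ x n → x :+ n :* x := (con 1ℤ :+ n) :* x) refl x ⟦ + n ⟧ ⟩
    (⟦ 1ℤ ⟧ + ⟦ + n ⟧) * x         ≈⟨ *-congʳ (+-homo 1ℤ (+ n)) ⟨
    ⟦ + ℕ.suc n ⟧ * x              ∎

  sum-linear : ∀ {n} p q (f g : Fin n → Carrier) →
    sum (λ i → p * f i + q * g i) ≈ p * sum f + q * sum g
  sum-linear p q f g = trans (∑-distrib-+ (λ i → p * f i) (λ i → q * g i))
    (+-cong (sym (*-distribˡ-sum p f)) (sym (*-distribˡ-sum q g)))

  sum-δ : ∀ {n} (i : Fin n) (x : Fin n → Carrier) → sum (λ j → 𝟙 (does (i ≟ j)) * x j) ≈ x i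
  sum-δ zero    x = trans
    (+-cong (*-identityˡ (x zero)) (sum-0 _ λ j → zeroˡ (x (suc j))))
    (+-identityʳ (x zero))
  sum-δ (suc i) x = trans (+-cong (zeroˡ (x zero)) (sum-δ i (x ∘ suc))) (+-identityˡ _)

  -- The indicators of `i ≢ j` and of `i ≡ j` add up to 1, so restoring the diagonal term `x i`
  -- completes the sum.
  sum-clique : ∀ {n} (i : Fin n) (x : Fin n → Carrier) →
    sum (λ j → 𝟙 (not (does (i ≟ j))) * x j) ≈ sum x - x i
  sum-clique i x = begin
    S                  ≈⟨ solve 2 (λ s d → s := s :+ d :- d) refl S (x i) ⟩
    S + x i - x i      ≈⟨ +-congʳ (+-congˡ (sum-δ i x)) ⟨
    S + sum (λ j → 𝟙 (does (i ≟ j)) * x j) - x i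
                       ≈⟨ +-congʳ (∑-distrib-+ (λ j → 𝟙 (not (does (i ≟ j))) * x j)
                                               (λ j → 𝟙 (does (i ≟ j)) * x j)) ⟨
    sum (λ j → 𝟙 (not (does (i ≟ j))) * x j + 𝟙 (does (i ≟ j)) * x j) - x i
                       ≈⟨ +-congʳ (sum-cong-≋ λ j → complement (does (i ≟ j)) (x j)) ⟩
    sum x - x i        ∎
    where
    S = sum (λ j → 𝟙 (not (does (i ≟ j))) * x j)
    complement : ∀ b y → 𝟙 (not b) * y + 𝟙 b * y ≈ y
    complement true  y = trans (+-cong (zeroˡ y) (*-identityˡ y)) (+-identityˡ y)
    complement false y = trans (+-cong (*-identityˡ y) (zeroˡ y)) (+-identityʳ y)

  ⟦sum⟧ : ∀ {n} (f : Fin n → ℤ) → ⟦ ℤΣ.sum f ⟧ ≈ sum (⟦_⟧ ∘ f)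
  ⟦sum⟧ {ℕ.zero}  f = 0-homo
  ⟦sum⟧ {ℕ.suc n} f = trans (+-homo (f zero) _) (+-congˡ (⟦sum⟧ (f ∘ suc)))

  ⟦𝟙⟧ : ∀ b → ⟦ 𝟙ℤ b ⟧ ≈ 𝟙 b
  ⟦𝟙⟧ true  = 1-homo
  ⟦𝟙⟧ false = 0-homo

  integral-eigenvector : ∀ {n} (adj : Fin n → Fin n → Bool) t (z : Fin n → ℤ) →
    (∀ i → ℤΣ.sum (λ j → 𝟙ℤ (adj i j) ℤ.* z j) ≡ t ℤ.* z i) →
    IsEigenvector adj ⟦ t ⟧ (⟦_⟧ ∘ z)
  integral-eigenvector adj t z eq i = begin
    sum (λ j → 𝟙 (adj i j) * ⟦ z j ⟧)
      ≈⟨ sum-cong-≋ (λ j → trans (*-homo (𝟙ℤ (adj i j)) (z j)) (*-congʳ (⟦𝟙⟧ (adj i j)))) ⟨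
    sum (λ j → ⟦ 𝟙ℤ (adj i j) ℤ.* z j ⟧)     ≈⟨ ⟦sum⟧ (λ j → 𝟙ℤ (adj i j) ℤ.* z j) ⟨
    ⟦ ℤΣ.sum (λ j → 𝟙ℤ (adj i j) ℤ.* z j) ⟧   ≡⟨ ≡.cong ⟦_⟧ (eq i) ⟩
    ⟦ t ℤ.* z i ⟧                            ≈⟨ *-homo t (z i) ⟩
    ⟦ t ⟧ * ⟦ z i ⟧                          ∎

  pairing : ∀ {n} → Vec ℤ n → (Fin n → Carrier) → Carrier
  pairing z w = sum (λ i → ⟦ lookup z i ⟧ * w i)

  module _ {n} (adj : Fin n → Fin n → Bool) {μ w} (eig : IsEigenvector adj μ w) where

    pairing-shift : ∀ t z → pairing (shift adj t z) w ≈ (μ - ⟦ t ⟧) * pairing z w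
    pairing-shift t z = begin
      sum (λ i → ⟦ lookup (shift adj t z) i ⟧ * w i)
        ≈⟨ sum-cong-≋ (λ i → *-congʳ (entry i)) ⟩
      sum (λ i → (sum (λ j → 𝟙 (adj j i) * ζ j) - ⟦ t ⟧ * ζ i) * w i)
        ≈⟨ sum-cong-≋ (λ i → solve 4 (λ s t z w → (s :- t :* z) :* w := con 1ℤ :* (w :* s) :+ (:- t) :* (z :* w))
             refl (sum (λ j → 𝟙 (adj j i) * ζ j)) ⟦ t ⟧ (ζ i) (w i)) ⟩
      sum (λ i → ⟦ 1ℤ ⟧ * (w i * sum (λ j → 𝟙 (adj j i) * ζ j)) + (- ⟦ t ⟧) * (ζ i * w i))
        ≈⟨ sum-linear ⟦ 1ℤ ⟧ (- ⟦ t ⟧) (λ i → w i * sum (λ j → 𝟙 (adj j i) * ζ j)) (λ i → ζ i * w i) ⟩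
      ⟦ 1ℤ ⟧ * sum (λ i → w i * sum (λ j → 𝟙 (adj j i) * ζ j)) + (- ⟦ t ⟧) * pairing z w
        ≈⟨ +-congʳ (*-congˡ transpose) ⟩
      ⟦ 1ℤ ⟧ * (μ * pairing z w) + (- ⟦ t ⟧) * pairing z w
        ≈⟨ solve 3 (λ μ t p → con 1ℤ :* (μ :* p) :+ (:- t) :* p := (μ :- t) :* p) refl μ ⟦ t ⟧ (pairing z w) ⟩
      (μ - ⟦ t ⟧) * pairing z w ∎
      where
      ζ = λ i → ⟦ lookup z i ⟧

      entry : ∀ i → ⟦ lookup (shift adj t z) i ⟧ ≈ sum (λ j → 𝟙 (adj j i) * ζ j) - ⟦ t ⟧ * ζ i
      entry i = begin
        ⟦ lookup (shift adj t z) i ⟧  ≡⟨ ≡.cong ⟦_⟧ (lookup∘tabulate _ i) ⟩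
        ⟦ Σz ℤ.- t ℤ.* lookup z i ⟧   ≈⟨ +-homo Σz (ℤ.- (t ℤ.* lookup z i)) ⟩
        ⟦ Σz ⟧ + ⟦ ℤ.- (t ℤ.* lookup z i) ⟧
          ≈⟨ +-cong (⟦sum⟧ (λ j → 𝟙ℤ (adj j i) ℤ.* lookup z j))
                    (trans (-‿homo (t ℤ.* lookup z i)) (-‿cong (*-homo t (lookup z i)))) ⟩
        sum (λ j → ⟦ 𝟙ℤ (adj j i) ℤ.* lookup z j ⟧) - ⟦ t ⟧ * ζ i
          ≈⟨ +-congʳ (sum-cong-≋ λ j → trans (*-homo (𝟙ℤ (adj j i)) (lookup z j)) (*-congʳ (⟦𝟙⟧ (adj j i)))) ⟩
        sum (λ j → 𝟙 (adj j i) * ζ j) - ⟦ t ⟧ * ζ i ∎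
        where Σz = ℤΣ.sum (λ j → 𝟙ℤ (adj j i) ℤ.* lookup z j)

      -- `shift` acts by the transpose of `adj`. After exchanging the two sums, the inner one is row
      -- `j` of `adj` applied to `w`, which `eig` evaluates.
      transpose : sum (λ i → w i * sum (λ j → 𝟙 (adj j i) * ζ j)) ≈ μ * pairing z w
      transpose = begin
        sum (λ i → w i * sum (λ j → 𝟙 (adj j i) * ζ j))
          ≈⟨ sum-cong-≋ (λ i → *-distribˡ-sum (w i) (λ j → 𝟙 (adj j i) * ζ j)) ⟩
        sum (λ i → sum (λ j → w i * (𝟙 (adj j i) * ζ j)))
          ≈⟨ ∑-comm (λ i j → w i * (𝟙 (adj j i) * ζ j)) ⟩
        sum (λ j → sum (λ i → w i * (𝟙 (adj j i) * ζ j)))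
          ≈⟨ sum-cong-≋ (λ j → trans
               (sum-cong-≋ λ i → solve 3 (λ w a z → w :* (a :* z) := z :* (a :* w)) refl (w i) (𝟙 (adj j i)) (ζ j))
               (sym (*-distribˡ-sum (ζ j) (λ i → 𝟙 (adj j i) * w i)))) ⟩
        sum (λ j → ζ j * sum (λ i → 𝟙 (adj j i) * w i))
          ≈⟨ sum-cong-≋ (λ j → trans (*-congˡ (eig j))
               (solve 3 (λ z μ w → z :* (μ :* w) := μ :* (z :* w)) refl (ζ j) μ (w j))) ⟩
        sum (λ j → μ * (ζ j * w j))
          ≈⟨ *-distribˡ-sum μ (λ j → ζ j * w j) ⟨
        μ * pairing z w ∎

    pairing-shifts : ∀ {k} (θ : Fin k → ℤ) z →
      pairing (shifts adj θ z) w ≈ factors θ μ (pairing z w)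
    pairing-shifts {ℕ.zero}  θ z = refl
    pairing-shifts {ℕ.suc k} θ z = trans (pairing-shift (θ zero) (shifts adj (θ ∘ suc) z))
      (*-congˡ (pairing-shifts (θ ∘ suc) z))

  shifts-annihilate : ∀ {k n} (θ : Fin k → ℤ) (adj : Fin n → Fin n → Bool) →
    (∀ i → shifts adj θ (basis i) ≡ Vec.replicate n 0ℤ) → Annihilates θ adj
  shifts-annihilate {n = n} θ adj vanish μ w eig i = begin
    factors θ μ (w i)                     ≈⟨ factors-cong θ μ pairing-basis ⟨
    factors θ μ (pairing (basis i) w)     ≈⟨ pairing-shifts adj eig θ (basis i) ⟨
    pairing (shifts adj θ (basis i)) w    ≡⟨ ≡.cong (λ z → pairing z w) (vanish i) ⟩
    pairing (Vec.replicate n 0ℤ) w        ≈⟨ sum-0 _ (λ j → trans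
                                               (*-congʳ (trans (reflexive (≡.cong ⟦_⟧ (lookup-replicate j 0ℤ))) 0-homo))
                                               (zeroˡ (w j))) ⟩
    0#                                    ∎
    where
    pairing-basis : pairing (basis i) w ≈ w i
    pairing-basis = trans
      (sum-cong-≋ λ j → *-congʳ (trans (reflexive (≡.cong ⟦_⟧ (lookup∘tabulate _ j))) (⟦𝟙⟧ (does (i ≟ j)))))
      (sum-δ i w)

  -- The eigenvalue equations of a clique with blocks.

  module BlockGraph
    {v b} (mem : Fin b → Fin v → Bool) (d l : ℕ)
    (design : ∀ i j → ℕΣ.sum (λ k → 𝟙ℕ (mem k i ∧ mem k j)) ≡ (if does (i ≟ j) then d else 0) ℕ.+ l)
    where

    adj = cliqueWithBlocks mem
    D = ⟦ + d ⟧
    Λ = ⟦ + l ⟧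
    V = ⟦ + v ⟧

    blockSum : (Fin v → Carrier) → Fin b → Carrier
    blockSum x k = sum (λ j → 𝟙 (mem k j) * x j)

    pointSum : (Fin b → Carrier) → Fin v → Carrier
    pointSum y i = sum (λ k → 𝟙 (mem k i) * y k)

    -- This is `N Nᵀ = (r - λ) I + λ J` entrywise, with `D` for `r - λ` and `Λ` for `λ`: a product
    -- of two incidences is the indicator of a conjunction, and `design` counts these.
    gram : ∀ i j → sum (λ k → 𝟙 (mem k i) * 𝟙 (mem k j)) ≈ D * 𝟙 (does (i ≟ j)) + Λ * 1#
    gram i j = begin
      sum (λ k → 𝟙 (mem k i) * 𝟙 (mem k j))
        ≈⟨ sum-cong-≋ (λ k → 𝟙-∧ (mem k i) (mem k j)) ⟨
      sum (λ k → 𝟙 (mem k i ∧ mem k j))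
        ≈⟨ count (λ k → mem k i ∧ mem k j) ⟨
      ⟦ + ℕΣ.sum (λ k → 𝟙ℕ (mem k i ∧ mem k j)) ⟧
        ≡⟨ ≡.cong (λ m → ⟦ + m ⟧) (design i j) ⟩
      ⟦ + ((if does (i ≟ j) then d else 0) ℕ.+ l) ⟧
        ≈⟨ +-homo (+ (if does (i ≟ j) then d else 0)) (+ l) ⟩
      ⟦ + (if does (i ≟ j) then d else 0) ⟧ + Λ
        ≈⟨ +-cong (diagonal (does (i ≟ j))) (sym (*-identityʳ Λ)) ⟩
      D * 𝟙 (does (i ≟ j)) + Λ * 1# ∎
      where
      𝟙-∧ : ∀ p q → 𝟙 (p ∧ q) ≈ 𝟙 p * 𝟙 q
      𝟙-∧ true  q = sym (*-identityˡ (𝟙 q))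
      𝟙-∧ false q = sym (zeroˡ (𝟙 q))

      count : ∀ {n} (p : Fin n → Bool) → ⟦ + ℕΣ.sum (𝟙ℕ ∘ p) ⟧ ≈ sum (𝟙 ∘ p)
      count {ℕ.zero}  p = 0-homo
      count {ℕ.suc n} p = trans
        (+-homo (+ 𝟙ℕ (p zero)) (+ ℕΣ.sum (𝟙ℕ ∘ p ∘ suc)))
        (+-cong (bit (p zero)) (count (p ∘ suc)))
        where
        bit : ∀ q → ⟦ + 𝟙ℕ q ⟧ ≈ 𝟙 q
        bit true  = 1-homo
        bit false = 0-homo

      diagonal : ∀ q → ⟦ + (if q then d else 0) ⟧ ≈ D * 𝟙 q
      diagonal true  = sym (*-identityʳ D)
      diagonal false = trans 0-homo (sym (zeroʳ D))

    pointSum-blockSum : ∀ x i → pointSum (blockSum x) i ≈ D * x i + Λ * sum x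
    pointSum-blockSum x i = begin
      sum (λ k → 𝟙 (mem k i) * blockSum x k)
        ≈⟨ sum-cong-≋ (λ k → *-distribˡ-sum (𝟙 (mem k i)) (λ j → 𝟙 (mem k j) * x j)) ⟩
      sum (λ k → sum (λ j → 𝟙 (mem k i) * (𝟙 (mem k j) * x j)))
        ≈⟨ ∑-comm (λ k j → 𝟙 (mem k i) * (𝟙 (mem k j) * x j)) ⟩
      sum (λ j → sum (λ k → 𝟙 (mem k i) * (𝟙 (mem k j) * x j)))
        ≈⟨ sum-cong-≋ (λ j → trans
             (sum-cong-≋ λ k → sym (*-assoc (𝟙 (mem k i)) (𝟙 (mem k j)) (x j)))
             (sym (*-distribʳ-sum (x j) (λ k → 𝟙 (mem k i) * 𝟙 (mem k j))))) ⟩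
      sum (λ j → sum (λ k → 𝟙 (mem k i) * 𝟙 (mem k j)) * x j)
        ≈⟨ sum-cong-≋ (λ j → trans (*-congʳ (gram i j)) (distribʳ (x j) _ _)) ⟩
      sum (λ j → D * 𝟙 (does (i ≟ j)) * x j + Λ * 1# * x j)
        ≈⟨ sum-cong-≋ (λ j → +-cong (*-assoc D (𝟙 (does (i ≟ j))) (x j))
             (trans (*-assoc Λ 1# (x j)) (*-congˡ (*-identityˡ (x j))))) ⟩
      sum (λ j → D * (𝟙 (does (i ≟ j)) * x j) + Λ * x j)
        ≈⟨ sum-linear D Λ (λ j → 𝟙 (does (i ≟ j)) * x j) x ⟩
      D * sum (λ j → 𝟙 (does (i ≟ j)) * x j) + Λ * sum x
        ≈⟨ +-congʳ (*-congˡ (sum-δ i x)) ⟩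
      D * x i + Λ * sum x ∎

    row-point : ∀ i (w : Fin (v ℕ.+ b) → Carrier) →
      sum (λ j → 𝟙 (adj (i ↑ˡ b) j) * w j) ≈
      (sum (λ j → w (j ↑ˡ b)) - w (i ↑ˡ b)) + pointSum (λ k → w (v ↑ʳ k)) i
    row-point i w = begin
      sum (λ j → 𝟙 (adj (i ↑ˡ b) j) * w j)
        ≈⟨ sum-splitAt +-commutativeMonoid v (λ j → 𝟙 (adj (i ↑ˡ b) j) * w j) ⟩
      sum (λ j → 𝟙 (adj (i ↑ˡ b) (j ↑ˡ b)) * w (j ↑ˡ b)) +
      sum (λ k → 𝟙 (adj (i ↑ˡ b) (v ↑ʳ k)) * w (v ↑ʳ k))
        ≡⟨ ≡.cong₂ _+_
             (sum-cong-≗ λ j → ≡.cong (λ q → 𝟙 q * w (j ↑ˡ b)) (adj-↑ˡ-↑ˡ mem i j))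
             (sum-cong-≗ λ k → ≡.cong (λ q → 𝟙 q * w (v ↑ʳ k)) (adj-↑ˡ-↑ʳ mem i k)) ⟩
      sum (λ j → 𝟙 (not (does (i ≟ j))) * w (j ↑ˡ b)) + pointSum (λ k → w (v ↑ʳ k)) i
        ≈⟨ +-congʳ (sum-clique i (λ j → w (j ↑ˡ b))) ⟩
      (sum (λ j → w (j ↑ˡ b)) - w (i ↑ˡ b)) + pointSum (λ k → w (v ↑ʳ k)) i ∎

    row-block : ∀ k (w : Fin (v ℕ.+ b) → Carrier) →
      sum (λ j → 𝟙 (adj (v ↑ʳ k) j) * w j) ≈ blockSum (λ j → w (j ↑ˡ b)) k
    row-block k w = begin
      sum (λ j → 𝟙 (adj (v ↑ʳ k) j) * w j)
        ≈⟨ sum-splitAt +-commutativeMonoid v (λ j → 𝟙 (adj (v ↑ʳ k) j) * w j) ⟩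
      sum (λ j → 𝟙 (adj (v ↑ʳ k) (j ↑ˡ b)) * w (j ↑ˡ b)) +
      sum (λ l → 𝟙 (adj (v ↑ʳ k) (v ↑ʳ l)) * w (v ↑ʳ l))
        ≡⟨ ≡.cong₂ _+_
             (sum-cong-≗ λ j → ≡.cong (λ q → 𝟙 q * w (j ↑ˡ b)) (adj-↑ʳ-↑ˡ mem k j))
             (sum-cong-≗ λ l → ≡.cong (λ q → 𝟙 q * w (v ↑ʳ l)) (adj-↑ʳ-↑ʳ mem k l)) ⟩
      blockSum (λ j → w (j ↑ˡ b)) k + sum (λ l → 0# * w (v ↑ʳ l))
        ≈⟨ +-congˡ (sum-0 _ λ l → zeroˡ (w (v ↑ʳ l))) ⟩
      blockSum (λ j → w (j ↑ˡ b)) k + 0#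
        ≈⟨ +-identityʳ _ ⟩
      blockSum (λ j → w (j ↑ˡ b)) k ∎

    glue : (Fin v → Carrier) → (Fin b → Carrier) → Fin (v ℕ.+ b) → Carrier
    glue x y = [ x , y ]′ ∘ splitAt v

    glue-↑ˡ : ∀ x y i → glue x y (i ↑ˡ b) ≡ x i
    glue-↑ˡ x y i = ≡.cong [ x , y ]′ (splitAt-↑ˡ v i b)

    glue-↑ʳ : ∀ x y k → glue x y (v ↑ʳ k) ≡ y k
    glue-↑ʳ x y k = ≡.cong [ x , y ]′ (splitAt-↑ʳ v b k)

    glue-eigenvector : ∀ μ x y →
      (∀ i → (sum x - x i) + pointSum y i ≈ μ * x i) → (∀ k → blockSum x k ≈ μ * y k) →
      IsEigenvector adj μ (glue x y)
    glue-eigenvector μ x y at-points at-blocks = splitAt-elim v _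
      (λ i → begin
        sum (λ j → 𝟙 (adj (i ↑ˡ b) j) * glue x y j)
          ≈⟨ row-point i (glue x y) ⟩
        (sum (λ j → glue x y (j ↑ˡ b)) - glue x y (i ↑ˡ b)) + pointSum (λ k → glue x y (v ↑ʳ k)) i
          ≡⟨ ≡.cong₂ _+_
               (≡.cong₂ _-_ (sum-cong-≗ (glue-↑ˡ x y)) (glue-↑ˡ x y i))
               (sum-cong-≗ λ k → ≡.cong (𝟙 (mem k i) *_) (glue-↑ʳ x y k)) ⟩
        (sum x - x i) + pointSum y i
          ≈⟨ at-points i ⟩
        μ * x i
          ≡⟨ ≡.cong (μ *_) (glue-↑ˡ x y i) ⟨
        μ * glue x y (i ↑ˡ b) ∎)
      (λ k → begin
        sum (λ j → 𝟙 (adj (v ↑ʳ k) j) * glue x y j)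
          ≈⟨ row-block k (glue x y) ⟩
        blockSum (λ j → glue x y (j ↑ˡ b)) k
          ≡⟨ sum-cong-≗ (λ j → ≡.cong (𝟙 (mem k j) *_) (glue-↑ˡ x y j)) ⟩
        blockSum x k
          ≈⟨ at-blocks k ⟩
        μ * y k
          ≡⟨ ≡.cong (μ *_) (glue-↑ʳ x y k) ⟨
        μ * glue x y (v ↑ʳ k) ∎)

    -- Taking `x = μ u` and `y = Nᵀ u` satisfies the block rows for any `u` without dividing by `μ`.
    -- Only the point rows remain, and `N Nᵀ` turns them into a condition on `u` alone.
    lifted-eigenvector : ∀ μ u →
      (∀ i → μ * (μ * u i) ≈ (μ + Λ) * sum u + (D - μ) * u i) →
      IsEigenvector adj μ (glue (λ i → μ * u i) (blockSum u))
    lifted-eigenvector μ u quadratic = glue-eigenvector μ (λ i → μ * u i) (blockSum u)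
      (λ i → begin
        (sum (λ j → μ * u j) - μ * u i) + pointSum (blockSum u) i
          ≈⟨ +-cong (+-congʳ (sym (*-distribˡ-sum μ u))) (pointSum-blockSum u i) ⟩
        (μ * sum u - μ * u i) + (D * u i + Λ * sum u)
          ≈⟨ solve 5 (λ μ s u d l → (μ :* s :- μ :* u) :+ (d :* u :+ l :* s)
               := (μ :+ l) :* s :+ (d :- μ) :* u) refl μ (sum u) (u i) D Λ ⟩
        (μ + Λ) * sum u + (D - μ) * u i
          ≈⟨ quadratic i ⟨
        μ * (μ * u i) ∎)
      (λ k → begin
        sum (λ j → 𝟙 (mem k j) * (μ * u j))
          ≈⟨ sum-cong-≋ (λ j → solve 3 (λ a μ u → a :* (μ :* u) := μ :* (a :* u)) refl (𝟙 (mem k j)) μ (u j)) ⟩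
        sum (λ j → μ * (𝟙 (mem k j) * u j))
          ≈⟨ *-distribˡ-sum μ (λ j → 𝟙 (mem k j) * u j) ⟨
        μ * blockSum u k ∎)

    module _ {μ w} (eig : IsEigenvector adj μ w) where
      x : Fin v → Carrier
      x i = w (i ↑ˡ b)

      y : Fin b → Carrier
      y k = w (v ↑ʳ k)

      block-equation : ∀ k → μ * y k ≈ blockSum x k
      block-equation k = trans (sym (eig (v ↑ʳ k))) (row-block k w)

      -- Multiplying the point row by `μ` first allows `μ y` to be replaced by `Nᵀ x`, so `y` is
      -- eliminated through `N Nᵀ`.
      point-equation : ∀ i → μ * (μ * x i) ≈ (μ + Λ) * sum x + (D - μ) * x i
      point-equation i = begin
        μ * (μ * x i)
          ≈⟨ *-congˡ (trans (sym (eig (i ↑ˡ b))) (row-point i w)) ⟩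
        μ * ((sum x - x i) + pointSum y i)
          ≈⟨ distribˡ μ _ _ ⟩
        μ * (sum x - x i) + μ * pointSum y i
          ≈⟨ +-congˡ (*-distribˡ-sum μ (λ k → 𝟙 (mem k i) * y k)) ⟩
        μ * (sum x - x i) + sum (λ k → μ * (𝟙 (mem k i) * y k))
          ≈⟨ +-congˡ (sum-cong-≋ λ k → trans
               (solve 3 (λ μ a y → μ :* (a :* y) := a :* (μ :* y)) refl μ (𝟙 (mem k i)) (y k))
               (*-congˡ (block-equation k))) ⟩
        μ * (sum x - x i) + pointSum (blockSum x) i
          ≈⟨ +-congˡ (pointSum-blockSum x i) ⟩
        μ * (sum x - x i) + (D * x i + Λ * sum x)
          ≈⟨ solve 5 (λ μ s u d l → μ :* (s :- u) :+ (d :* u :+ l :* s)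
               := (μ :+ l) :* s :+ (d :- μ) :* u) refl μ (sum x) (x i) D Λ ⟩
        (μ + Λ) * sum x + (D - μ) * x i ∎

      sum-equation : μ * (μ * sum x) ≈ V * ((μ + Λ) * sum x) + (D - μ) * sum x
      sum-equation = begin
        μ * (μ * sum x)
          ≈⟨ *-congˡ (*-distribˡ-sum μ x) ⟩
        μ * sum (λ i → μ * x i)
          ≈⟨ *-distribˡ-sum μ (λ i → μ * x i) ⟩
        sum (λ i → μ * (μ * x i))
          ≈⟨ sum-cong-≋ point-equation ⟩
        sum (λ i → (μ + Λ) * sum x + (D - μ) * x i)
          ≈⟨ ∑-distrib-+ (λ _ → (μ + Λ) * sum x) (λ i → (D - μ) * x i) ⟩
        sum {v} (λ _ → (μ + Λ) * sum x) + sum (λ i → (D - μ) * x i)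
          ≈⟨ +-cong (sum-const v _) (sym (*-distribˡ-sum (D - μ) x)) ⟩
        V * ((μ + Λ) * sum x) + (D - μ) * sum x ∎

    -- The hypotheses are Vieta's relations: `t₁` and `t₂` are the roots of `μ² + μ - d`, and `a₁`
    -- and `a₂` those of `μ² - (v - 1) μ - (d + v l)`.
    module Roots (t₁ t₂ a₁ a₂ : ℤ)
      (t-sum : t₁ ℤ.+ t₂ ≡ -1ℤ) (t-product : t₁ ℤ.* t₂ ≡ ℤ.- (+ d))
      (a-sum : a₁ ℤ.+ a₂ ℤ.+ 1ℤ ≡ + v) (a-product : a₁ ℤ.* a₂ ≡ ℤ.- (+ d ℤ.+ + v ℤ.* + l))
      where

      T₁ = ⟦ t₁ ⟧
      T₂ = ⟦ t₂ ⟧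
      A₁ = ⟦ a₁ ⟧
      A₂ = ⟦ a₂ ⟧

      T-sum : T₁ + T₂ ≈ ⟦ -1ℤ ⟧
      T-sum = trans (sym (+-homo t₁ t₂)) (reflexive (≡.cong ⟦_⟧ t-sum))

      T-product : T₁ * T₂ ≈ - D
      T-product = trans (sym (*-homo t₁ t₂)) (trans (reflexive (≡.cong ⟦_⟧ t-product)) (-‿homo (+ d)))

      A-sum : A₁ + A₂ ≈ V - ⟦ 1ℤ ⟧
      A-sum = begin
        A₁ + A₂                      ≈⟨ solve 1 (λ a → a := a :+ con 1ℤ :- con 1ℤ) refl (A₁ + A₂) ⟩
        A₁ + A₂ + ⟦ 1ℤ ⟧ - ⟦ 1ℤ ⟧    ≈⟨ +-congʳ (+-congʳ (+-homo a₁ a₂)) ⟨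
        ⟦ a₁ ℤ.+ a₂ ⟧ + ⟦ 1ℤ ⟧ - ⟦ 1ℤ ⟧ ≈⟨ +-congʳ (+-homo (a₁ ℤ.+ a₂) 1ℤ) ⟨
        ⟦ a₁ ℤ.+ a₂ ℤ.+ 1ℤ ⟧ - ⟦ 1ℤ ⟧ ≡⟨ ≡.cong (λ z → ⟦ z ⟧ - ⟦ 1ℤ ⟧) a-sum ⟩
        V - ⟦ 1ℤ ⟧                   ∎

      A-product : A₁ * A₂ ≈ - (D + V * Λ)
      A-product = begin
        A₁ * A₂                        ≈⟨ *-homo a₁ a₂ ⟨
        ⟦ a₁ ℤ.* a₂ ⟧                  ≡⟨ ≡.cong ⟦_⟧ a-product ⟩
        ⟦ ℤ.- (+ d ℤ.+ + v ℤ.* + l) ⟧  ≈⟨ -‿homo (+ d ℤ.+ + v ℤ.* + l) ⟩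
        - ⟦ + d ℤ.+ + v ℤ.* + l ⟧      ≈⟨ -‿cong (trans (+-homo (+ d) (+ v ℤ.* + l)) (+-congˡ (*-homo (+ v) (+ l)))) ⟩
        - (D + V * Λ)                  ∎

      expand : ∀ {p q P Q} → p + q ≈ P → p * q ≈ Q → ∀ μ y →
        (μ - p) * ((μ - q) * y) ≈ μ * (μ * y) - P * (μ * y) + Q * y
      expand {p} {q} {P} {Q} +≈ *≈ μ y = begin
        (μ - p) * ((μ - q) * y)
          ≈⟨ solve 4 (λ p q μ y → (μ :- p) :* ((μ :- q) :* y)
               := μ :* (μ :* y) :- (p :+ q) :* (μ :* y) :+ p :* q :* y) refl p q μ y ⟩
        μ * (μ * y) - (p + q) * (μ * y) + p * q * y
          ≈⟨ +-cong (+-congˡ (-‿cong (*-congʳ +≈))) (*-congʳ *≈) ⟩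
        μ * (μ * y) - P * (μ * y) + Q * y ∎

      annihilates : Annihilates (spectrum t₁ t₂ a₁ a₂) adj
      annihilates μ w eig = splitAt-elim v _
        -- On the points the four factors in `G` already give zero, whatever the factor for the
        -- eigenvalue 0.
        (λ i → trans (*-congˡ (G-x i)) (zeroʳ _))
        -- On the blocks the factor `μ` from the eigenvalue 0 is what turns `y` into `Nᵀ x`, a
        -- combination of coordinates that `G` kills.
        (λ k → begin
          (μ - ⟦ 0ℤ ⟧) * G (yₑ k)
            ≈⟨ solve 2 (λ μ g → (μ :- con 0ℤ) :* g := μ :* g) refl μ (G (yₑ k)) ⟩
          μ * G (yₑ k)
            ≈⟨ G-scale μ (yₑ k) ⟨
          G (μ * yₑ k)
            ≈⟨ G-cong (block-equation eig k) ⟩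
          G (blockSum xₑ k)
            ≈⟨ G-as-product (blockSum xₑ k) ⟩
          c * blockSum xₑ k
            ≈⟨ *-distribˡ-sum c (λ j → 𝟙 (mem k j) * xₑ j) ⟩
          sum (λ j → c * (𝟙 (mem k j) * xₑ j))
            ≈⟨ sum-0 _ (λ j → begin
                 c * (𝟙 (mem k j) * xₑ j)      ≈⟨ G-as-product _ ⟨
                 G (𝟙 (mem k j) * xₑ j)        ≈⟨ G-scale (𝟙 (mem k j)) (xₑ j) ⟩
                 𝟙 (mem k j) * G (xₑ j)        ≈⟨ *-congˡ (G-x j) ⟩
                 𝟙 (mem k j) * 0#              ≈⟨ zeroʳ _ ⟩
                 0#                            ∎) ⟩
          0# ∎)
        where
        xₑ = x eig
        yₑ = y eig
        σ  = sum xₑ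

        G : Carrier → Carrier
        G z = (μ - T₁) * ((μ - T₂) * ((μ - A₁) * ((μ - A₂) * z)))

        c : Carrier
        c = (μ - T₁) * ((μ - T₂) * ((μ - A₁) * (μ - A₂)))

        G-as-product : ∀ z → G z ≈ c * z
        G-as-product z = solve 5 (λ p q r s z → p :* (q :* (r :* (s :* z))) := p :* (q :* (r :* s)) :* z)
          refl (μ - T₁) (μ - T₂) (μ - A₁) (μ - A₂) z

        G-cong : ∀ {y z} → y ≈ z → G y ≈ G z
        G-cong y≈z = *-congˡ (*-congˡ (*-congˡ (*-congˡ y≈z)))

        G-scale : ∀ a z → G (a * z) ≈ a * G z
        G-scale a z = solve 6 (λ p q r s a z →
            p :* (q :* (r :* (s :* (a :* z)))) := a :* (p :* (q :* (r :* (s :* z)))))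
          refl (μ - T₁) (μ - T₂) (μ - A₁) (μ - A₂) a z

        T-factors : ∀ i → (μ - T₁) * ((μ - T₂) * xₑ i) ≈ (μ + Λ) * σ
        T-factors i = begin
          (μ - T₁) * ((μ - T₂) * xₑ i)
            ≈⟨ expand T-sum T-product μ (xₑ i) ⟩
          μ * (μ * xₑ i) - ⟦ -1ℤ ⟧ * (μ * xₑ i) + (- D) * xₑ i
            ≈⟨ +-congʳ (+-congʳ (point-equation eig i)) ⟩
          ((μ + Λ) * σ + (D - μ) * xₑ i) - ⟦ -1ℤ ⟧ * (μ * xₑ i) + (- D) * xₑ i
            ≈⟨ solve 5 (λ μ l s d x → ((μ :+ l) :* s :+ (d :- μ) :* x) :- con -1ℤ :* (μ :* x) :+ (:- d) :* x
                 := (μ :+ l) :* s) refl μ Λ σ D (xₑ i) ⟩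
          (μ + Λ) * σ ∎

        A-factors : (μ - A₁) * ((μ - A₂) * σ) ≈ 0#
        A-factors = begin
          (μ - A₁) * ((μ - A₂) * σ)
            ≈⟨ expand A-sum A-product μ σ ⟩
          μ * (μ * σ) - (V - ⟦ 1ℤ ⟧) * (μ * σ) + (- (D + V * Λ)) * σ
            ≈⟨ +-congʳ (+-congʳ (sum-equation eig)) ⟩
          (V * ((μ + Λ) * σ) + (D - μ) * σ) - (V - ⟦ 1ℤ ⟧) * (μ * σ) + (- (D + V * Λ)) * σ
            ≈⟨ solve 5 (λ v μ l s d → (v :* ((μ :+ l) :* s) :+ (d :- μ) :* s) :- (v :- con 1ℤ) :* (μ :* s)
                   :+ (:- (d :+ v :* l)) :* s := con 0ℤ) refl V μ Λ σ D ⟩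
          ⟦ 0ℤ ⟧
            ≈⟨ 0-homo ⟩
          0# ∎

        -- The factors commute. The `T`-factors turn `x i` into a multiple of `σ`, and the
        -- `A`-factors kill `σ`.
        G-x : ∀ i → G (xₑ i) ≈ 0#
        G-x i = begin
          G (xₑ i)
            ≈⟨ solve 5 (λ p q r s z → p :* (q :* (r :* (s :* z))) := r :* (s :* (p :* (q :* z))))
                 refl (μ - T₁) (μ - T₂) (μ - A₁) (μ - A₂) (xₑ i) ⟩
          (μ - A₁) * ((μ - A₂) * ((μ - T₁) * ((μ - T₂) * xₑ i)))
            ≈⟨ *-congˡ (*-congˡ (T-factors i)) ⟩
          (μ - A₁) * ((μ - A₂) * ((μ + Λ) * σ))
            ≈⟨ solve 4 (λ r s m z → r :* (s :* (m :* z)) := m :* (r :* (s :* z)))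
                 refl (μ - A₁) (μ - A₂) (μ + Λ) σ ⟩
          (μ + Λ) * ((μ - A₁) * ((μ - A₂) * σ))
            ≈⟨ *-congˡ A-factors ⟩
          (μ + Λ) * 0#
            ≈⟨ zeroʳ _ ⟩
          0# ∎

      square : ∀ {p q P Q} → p + q ≈ P → p * q ≈ Q → p * p ≈ P * p - Q
      square {p} {q} {P} {Q} +≈ *≈ = begin
        p * p                      ≈⟨ solve 2 (λ p q → p :* p := (p :+ q) :* p :- p :* q) refl p q ⟩
        (p + q) * p - p * q        ≈⟨ +-cong (*-congʳ +≈) (-‿cong *≈) ⟩
        P * p - Q                  ∎

      -- When the sum of `u` vanishes, the condition of `lifted-eigenvector` loses its first term
      -- and reduces to `τ² + τ - d = 0`.
      zero-sum-eigenvector : ∀ {τ} → τ * τ ≈ ⟦ -1ℤ ⟧ * τ - - D → ∀ u → sum u ≈ 0# →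
        IsEigenvector adj τ (glue (λ i → τ * u i) (blockSum u))
      zero-sum-eigenvector {τ} root u σ≈0 = lifted-eigenvector τ u λ i → begin
        τ * (τ * u i)                        ≈⟨ *-assoc τ τ (u i) ⟨
        τ * τ * u i                          ≈⟨ *-congʳ root ⟩
        -- The constant 0 in the solved equation is a placeholder for `sum u`.
        (⟦ -1ℤ ⟧ * τ - - D) * u i            ≈⟨ solve 4 (λ τ d u l → (con -1ℤ :* τ :- :- d) :* u
                                                  := (τ :+ l) :* con 0ℤ :+ (d :- τ) :* u) refl τ D (u i) Λ ⟩
        (τ + Λ) * ⟦ 0ℤ ⟧ + (D - τ) * u i     ≈⟨ +-congʳ (*-congˡ (trans 0-homo (sym σ≈0))) ⟩
        (τ + Λ) * sum u + (D - τ) * u i      ∎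

      -- For `u = 1` the sum is `v`, and the condition of `lifted-eigenvector` becomes the second
      -- quadratic.
      constant-eigenvector : ∀ {α} → α * α ≈ (V - ⟦ 1ℤ ⟧) * α - - (D + V * Λ) →
        IsEigenvector adj α (glue (λ i → α * ⟦ 1ℤ ⟧) (blockSum (λ _ → ⟦ 1ℤ ⟧)))
      constant-eigenvector {α} root = lifted-eigenvector α (λ _ → ⟦ 1ℤ ⟧) λ i → begin
        α * (α * ⟦ 1ℤ ⟧)                     ≈⟨ *-assoc α α ⟦ 1ℤ ⟧ ⟨
        α * α * ⟦ 1ℤ ⟧                       ≈⟨ *-congʳ root ⟩
        ((V - ⟦ 1ℤ ⟧) * α - - (D + V * Λ)) * ⟦ 1ℤ ⟧
          ≈⟨ solve 4 (λ v α d l → ((v :- con 1ℤ) :* α :- :- (d :+ v :* l)) :* con 1ℤ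
               := (α :+ l) :* (v :* con 1ℤ) :+ (d :- α) :* con 1ℤ) refl V α D Λ ⟩
        (α + Λ) * (V * ⟦ 1ℤ ⟧) + (D - α) * ⟦ 1ℤ ⟧
          ≈⟨ +-congʳ (*-congˡ (sum-const v ⟦ 1ℤ ⟧)) ⟨
        (α + Λ) * sum {v} (λ _ → ⟦ 1ℤ ⟧) + (D - α) * ⟦ 1ℤ ⟧ ∎

  -- A nonzero integer entry serves as a positive witness that the eigenvector does not vanish.
  HasEigenvector : ∀ {n} → (Fin n → Fin n → Bool) → ℤ → Set
  HasEigenvector {n} adj t = Σ[ w ∈ (Fin n → Carrier) ] IsEigenvector adj ⟦ t ⟧ w ×
    Σ[ j ∈ Fin n ] Σ[ z ∈ ℤ ] z ≢ 0ℤ × w j ≈ ⟦ z ⟧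

  -- Eigenvectors for all five values.

  module _ {v b} (mem : Fin (2 ℕ.+ b) → Fin (2 ℕ.+ v) → Bool) (d l : ℕ)
    (design : ∀ i j → ℕΣ.sum (λ k → 𝟙ℕ (mem k i ∧ mem k j)) ≡ (if does (i ≟ j) then d else 0) ℕ.+ l)
    (twins : ∀ i → mem zero i ≡ mem (suc zero) i)
    (t₁ t₂ a₁ a₂ : ℤ)
    (t-sum : t₁ ℤ.+ t₂ ≡ -1ℤ) (t-product : t₁ ℤ.* t₂ ≡ ℤ.- (+ d))
    (a-sum : a₁ ℤ.+ a₂ ℤ.+ 1ℤ ≡ + (2 ℕ.+ v))
    (a-product : a₁ ℤ.* a₂ ≡ ℤ.- (+ d ℤ.+ + (2 ℕ.+ v) ℤ.* + l))
    (distinct : Injective _≡_ _≡_ (spectrum t₁ t₂ a₁ a₂))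
    where
    open BlockGraph mem d l design
    open Roots t₁ t₂ a₁ a₂ t-sum t-product a-sum a-product

    -- Used in two roles: on the blocks it spans part of the kernel, since the first two blocks are
    -- equal, and on the points it is a nonzero vector of sum zero.
    e₀-e₁ : ∀ {n} → Fin (2 ℕ.+ n) → Carrier
    e₀-e₁ zero          = ⟦ 1ℤ ⟧
    e₀-e₁ (suc zero)    = ⟦ -1ℤ ⟧
    e₀-e₁ (suc (suc _)) = ⟦ 0ℤ ⟧

    sum-e₀-e₁ : ∀ {n} (f : Fin (2 ℕ.+ n) → Carrier) → f zero ≈ f (suc zero) →
      sum (λ i → f i * e₀-e₁ i) ≈ 0#
    sum-e₀-e₁ f f₀≈f₁ = begin
      f zero * ⟦ 1ℤ ⟧ + (f (suc zero) * ⟦ -1ℤ ⟧ + sum (λ i → f (suc (suc i)) * ⟦ 0ℤ ⟧))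
        ≈⟨ +-cong (*-congʳ f₀≈f₁) (+-congˡ (sum-0 _ λ i → trans (*-congˡ 0-homo) (zeroʳ (f (suc (suc i)))))) ⟩
      f (suc zero) * ⟦ 1ℤ ⟧ + (f (suc zero) * ⟦ -1ℤ ⟧ + 0#)
        ≈⟨ +-congˡ (+-identityʳ _) ⟩
      f (suc zero) * ⟦ 1ℤ ⟧ + f (suc zero) * ⟦ -1ℤ ⟧
        ≈⟨ solve 1 (λ f → f :* con 1ℤ :+ f :* con -1ℤ := con 0ℤ) refl (f (suc zero)) ⟩
      ⟦ 0ℤ ⟧
        ≈⟨ 0-homo ⟩
      0# ∎

    sum-e₀-e₁≈0 : sum (e₀-e₁ {v}) ≈ 0#
    sum-e₀-e₁≈0 = trans (sum-cong-≋ {2 ℕ.+ v} λ i → sym (*-identityˡ (e₀-e₁ i)))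
      (sum-e₀-e₁ {v} (λ _ → 1#) refl)

    kernel-eigenvector : IsEigenvector adj ⟦ 0ℤ ⟧ (glue (λ _ → 0#) e₀-e₁)
    kernel-eigenvector = glue-eigenvector ⟦ 0ℤ ⟧ (λ _ → 0#) e₀-e₁
      (λ i → begin
        (sum {2 ℕ.+ v} (λ _ → 0#) - 0#) + pointSum e₀-e₁ i
          ≈⟨ +-cong (+-congʳ (sum-replicate-zero (2 ℕ.+ v)))
               (sum-e₀-e₁ (λ k → 𝟙 (mem k i)) (reflexive (≡.cong 𝟙 (twins i)))) ⟩
        (0# - 0#) + 0#     ≈⟨ +-identityʳ _ ⟩
        0# - 0#            ≈⟨ -‿inverseʳ 0# ⟩
        0#                 ≈⟨ zeroʳ ⟦ 0ℤ ⟧ ⟨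
        ⟦ 0ℤ ⟧ * 0#        ∎)
      (λ k → begin
        sum (λ j → 𝟙 (mem k j) * 0#)   ≈⟨ sum-0 _ (λ j → zeroʳ (𝟙 (mem k j))) ⟩
        0#                             ≈⟨ zeroˡ (e₀-e₁ k) ⟨
        0# * e₀-e₁ k                   ≈⟨ *-congʳ 0-homo ⟨
        ⟦ 0ℤ ⟧ * e₀-e₁ k               ∎)

    lifted-nonzero : ∀ t u → t ≢ 0ℤ → u zero ≡ ⟦ 1ℤ ⟧ →
      Σ[ j ∈ Fin (2 ℕ.+ v ℕ.+ (2 ℕ.+ b)) ] Σ[ z ∈ ℤ ]
        z ≢ 0ℤ × glue (λ i → ⟦ t ⟧ * u i) (blockSum u) j ≈ ⟦ z ⟧
    lifted-nonzero t u t≢0 u₀≡1 = zero {1 ℕ.+ v} ↑ˡ (2 ℕ.+ b) , t , t≢0 ,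
      trans (*-congˡ (reflexive u₀≡1)) (solve 1 (λ t → t :* con 1ℤ := t) refl ⟦ t ⟧)

    -- Position `zero` of the spectrum holds 0, so distinctness keeps the other entries away from
    -- it.
    nonzero : ∀ i → spectrum t₁ t₂ a₁ a₂ (suc i) ≢ 0ℤ
    nonzero i eq with () ← distinct {suc i} {zero} eq

    spectrum-eigenvectors : ∀ i → HasEigenvector adj (spectrum t₁ t₂ a₁ a₂ i)
    spectrum-eigenvectors 0F =
      glue (λ _ → 0#) e₀-e₁ , kernel-eigenvector , (2 ℕ.+ v) ↑ʳ zero , 1ℤ , (λ ()) ,
      reflexive (glue-↑ʳ (λ _ → 0#) e₀-e₁ zero)
    spectrum-eigenvectors 1F =
      _ , zero-sum-eigenvector (square T-sum T-product) e₀-e₁ sum-e₀-e₁≈0 ,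
      lifted-nonzero t₁ e₀-e₁ (nonzero 0F) ≡.refl
    spectrum-eigenvectors 2F =
      _ , zero-sum-eigenvector (square (trans (+-comm T₂ T₁) T-sum) (trans (*-comm T₂ T₁) T-product))
            e₀-e₁ sum-e₀-e₁≈0 ,
      lifted-nonzero t₂ e₀-e₁ (nonzero 1F) ≡.refl
    spectrum-eigenvectors 3F =
      _ , constant-eigenvector (square A-sum A-product) ,
      lifted-nonzero a₁ (λ _ → ⟦ 1ℤ ⟧) (nonzero 2F) ≡.refl
    spectrum-eigenvectors 4F =
      _ , constant-eigenvector (square (trans (+-comm A₂ A₁) A-sum) (trans (*-comm A₂ A₁) A-product)) ,
      lifted-nonzero a₂ (λ _ → ⟦ 1ℤ ⟧) (nonzero 3F) ≡.refl

open ≡ using (refl; sym; trans; cong; cong₂; subst; module ≡-Reasoning)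

-- Counting subsets, and the block design.

module _ where
  open import Data.Nat.Base using (_+_; _*_; _^_)

  module _ {a} {A : Set a} where

    count : (A → Bool) → List A → ℕ
    count p []       = 0
    count p (x ∷ xs) = 𝟙ℕ (p x) + count p xs

    count-cong : ∀ {p q : A → Bool} → (∀ x → p x ≡ q x) → ∀ xs → count p xs ≡ count q xs
    count-cong p≗q []       = refl
    count-cong p≗q (x ∷ xs) = cong₂ _+_ (cong 𝟙ℕ (p≗q x)) (count-cong p≗q xs)

    count-++ : ∀ p xs ys → count p (xs ++ ys) ≡ count p xs + count p ys
    count-++ p []       ys = refl
    count-++ p (x ∷ xs) ys = trans (cong (_+_ (𝟙ℕ (p x))) (count-++ p xs ys))
                                   (sym (ℕ.+-assoc (𝟙ℕ (p x)) _ _))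

    count-copies : ∀ p n xs → count p (List.concat (List.replicate n xs)) ≡ n * count p xs
    count-copies p zero    xs = refl
    count-copies p (suc n) xs = trans (count-++ p xs _) (cong (_+_ (count p xs)) (count-copies p n xs))

    count-false : ∀ xs → count (λ _ → false) xs ≡ 0
    count-false []       = refl
    count-false (x ∷ xs) = count-false xs

    sum-lookup : ∀ p xs → ℕΣ.sum (λ k → 𝟙ℕ (p (List.lookup xs k))) ≡ count p xs
    sum-lookup p []       = refl
    sum-lookup p (x ∷ xs) = cong (_+_ (𝟙ℕ (p x))) (sum-lookup p xs)

  count-map : ∀ {a} {A B : Set a} (p : B → Bool) (f : A → B) xs → count p (List.map f xs) ≡ count (p ∘ f) xs
  count-map p f []       = refl
  count-map p f (x ∷ xs) = cong (_+_ (𝟙ℕ (p (f x)))) (count-map p f xs)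

  both : ∀ {n} → Fin n → Fin n → Subset n → Bool
  both i j B = lookup B i ∧ lookup B j

  both-comm : ∀ {n} (i j : Fin n) B → both i j B ≡ both j i B
  both-comm i j B = Bool.∧-comm (lookup B i) (lookup B j)

  lookup-⊥ : ∀ {n} (i : Fin n) → lookup ⊥ i ≡ false
  lookup-⊥ i = lookup-replicate i outside

  -- The empty set is missing from `nonempty n`, so its extension by the new element, the singleton,
  -- is listed separately.
  nonempty : ∀ n → List (Subset n)
  nonempty zero    = []
  nonempty (suc n) = ⁅ zero ⁆ ∷ List.map (outside ∷_) (nonempty n) ++ List.map (inside ∷_) (nonempty n)

  count-nonempty : ∀ {n} (p : Subset (suc n) → Bool) → count p (nonempty (suc n)) ≡
    𝟙ℕ (p ⁅ zero ⁆) + (count (λ B → p (outside ∷ B)) (nonempty n) + count (λ B → p (inside ∷ B)) (nonempty n))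
  count-nonempty {n} p = cong (_+_ (𝟙ℕ (p ⁅ zero ⁆)))
    (trans (count-++ p (List.map (outside ∷_) (nonempty n)) _)
           (cong₂ _+_ (count-map p (outside ∷_) (nonempty n)) (count-map p (inside ∷_) (nonempty n))))

  nonempty-all : ∀ n → suc (count (λ _ → true) (nonempty n)) ≡ 2 ^ n
  nonempty-all zero    = refl
  nonempty-all (suc n) = begin
    suc (count (λ _ → true) (nonempty (suc n)))  ≡⟨ cong suc (count-nonempty {n} (λ _ → true)) ⟩
    suc (suc (c + c))
      ≡⟨ solve 1 (λ c → con 2 :+ (c :+ c) := con 2 :* (con 1 :+ c)) refl c ⟩
    2 * suc c                                    ≡⟨ cong (2 *_) (nonempty-all n) ⟩
    2 * 2 ^ n                                    ∎
    where
    open ≡-Reasoning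
    open +-*-Solver
    c = count (λ _ → true) (nonempty n)

  -- Half of all subsets contain a given point. The factor 2 stands on the left to avoid the
  -- exponent `n - 1`; `nonempty-pair` has a factor 4 for the same reason.
  nonempty-through : ∀ {n} (i : Fin n) → 2 * count (λ B → lookup B i) (nonempty n) ≡ 2 ^ n
  nonempty-through {suc n} zero = begin
    2 * count (λ B → lookup B zero) (nonempty (suc n))
      ≡⟨ cong (2 *_) (count-nonempty {n} (λ B → lookup B zero)) ⟩
    2 * (1 + (count (λ _ → false) (nonempty n) + count (λ _ → true) (nonempty n)))
      ≡⟨ cong (λ c → 2 * (1 + (c + count (λ _ → true) (nonempty n)))) (count-false (nonempty n)) ⟩
    2 * suc (count (λ _ → true) (nonempty n))
      ≡⟨ cong (2 *_) (nonempty-all n) ⟩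
    2 * 2 ^ n ∎
    where open ≡-Reasoning
  nonempty-through {suc n} (suc i) = begin
    2 * count (λ B → lookup B (suc i)) (nonempty (suc n))
      ≡⟨ cong (2 *_) (count-nonempty {n} (λ B → lookup B (suc i))) ⟩
    2 * (𝟙ℕ (lookup (⊥ {n}) i) + (c + c))
      ≡⟨ cong (λ b → 2 * (𝟙ℕ b + (c + c))) (lookup-⊥ i) ⟩
    2 * (c + c)
      ≡⟨ cong (λ d → 2 * (c + d)) (sym (ℕ.+-identityʳ c)) ⟩
    2 * (2 * c)
      ≡⟨ cong (2 *_) (nonempty-through i) ⟩
    2 * 2 ^ n ∎
    where
    open ≡-Reasoning
    c = count (λ B → lookup B i) (nonempty n)

  nonempty-pair : ∀ {n} (i j : Fin n) → i ≢ j → 4 * count (both i j) (nonempty n) ≡ 2 ^ n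
  nonempty-pair zero zero i≢j = contradiction refl i≢j
  -- A set containing 0 and `suc j` is a set through `j` in the smaller ground set with 0 added,
  -- which reduces pairs to single points.
  nonempty-pair {suc n} zero (suc j) _ = begin
    4 * count (both zero (suc j)) (nonempty (suc n))
      ≡⟨ cong (4 *_) (count-nonempty {n} (both zero (suc j))) ⟩
    4 * (𝟙ℕ (lookup (⊥ {n}) j) + (count (λ _ → false) (nonempty n) + c))
      ≡⟨ cong₂ (λ b d → 4 * (𝟙ℕ b + (d + c))) (lookup-⊥ j) (count-false (nonempty n)) ⟩
    4 * c
      ≡⟨ ℕ.*-assoc 2 2 c ⟩
    2 * (2 * c)
      ≡⟨ cong (2 *_) (nonempty-through j) ⟩
    2 * 2 ^ n ∎
    where
    open ≡-Reasoning
    c = count (λ B → lookup B j) (nonempty n)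
  nonempty-pair {suc n} (suc i) zero i≢j =
    trans (cong (4 *_) (count-cong (both-comm (suc i) zero) (nonempty (suc n))))
          (nonempty-pair zero (suc i) (i≢j ∘ sym))
  nonempty-pair {suc n} (suc i) (suc j) i≢j = begin
    4 * count (both (suc i) (suc j)) (nonempty (suc n))
      ≡⟨ cong (4 *_) (count-nonempty {n} (both (suc i) (suc j))) ⟩
    4 * (𝟙ℕ (both i j (⊥ {n})) + (c + c))
      ≡⟨ cong (λ b → 4 * (𝟙ℕ (b ∧ lookup (⊥ {n}) j) + (c + c))) (lookup-⊥ i) ⟩
    4 * (c + c)
      ≡⟨ solve 1 (λ c → con 4 :* (c :+ c) := con 2 :* (con 4 :* c)) refl c ⟩
    2 * (4 * c)
      ≡⟨ cong (2 *_) (nonempty-pair i j (i≢j ∘ cong suc)) ⟩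
    2 * 2 ^ n ∎
    where
    open ≡-Reasoning
    open +-*-Solver
    c = count (both i j) (nonempty n)

  nonempty-design : ∀ w (i j : Fin (2 + w)) →
    count (both i j) (nonempty (2 + w)) ≡ (if does (i ≟ j) then 2 ^ w else 0) + 2 ^ w
  nonempty-design w i j with i ≟ j
  ... | yes refl = ℕ.*-cancelˡ-≡ _ _ 2 (begin
    2 * count (both i i) (nonempty (2 + w))
      ≡⟨ cong (2 *_) (count-cong (λ B → Bool.∧-idem (lookup B i)) (nonempty (2 + w))) ⟩
    2 * count (λ B → lookup B i) (nonempty (2 + w))
      ≡⟨ nonempty-through i ⟩
    2 * (2 * 2 ^ w)
      ≡⟨ cong (λ d → 2 * (2 ^ w + d)) (ℕ.+-identityʳ (2 ^ w)) ⟩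
    2 * (2 ^ w + 2 ^ w) ∎)
    where open ≡-Reasoning
  ... | no i≢j = ℕ.*-cancelˡ-≡ _ _ 4
    (trans (nonempty-pair i j i≢j) (sym (ℕ.*-assoc 2 2 (2 ^ w))))

  singletons : ∀ n → List (Subset n)
  singletons zero    = []
  singletons (suc n) = ⁅ zero ⁆ ∷ List.map (outside ∷_) (singletons n)

  singletons-design : ∀ {n} (i j : Fin n) → count (both i j) (singletons n) ≡ 𝟙ℕ (does (i ≟ j))
  singletons-design {suc n} zero zero =
    cong suc (trans (count-map (both zero zero) (outside ∷_) (singletons n)) (count-false (singletons n)))
  singletons-design {suc n} zero (suc j) = cong₂ (λ b c → 𝟙ℕ b + c) (lookup-⊥ j)
    (trans (count-map (both zero (suc j)) (outside ∷_) (singletons n)) (count-false (singletons n)))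
  singletons-design {suc n} (suc i) zero =
    trans (count-cong (both-comm (suc i) zero) (singletons (suc n))) (singletons-design zero (suc i))
  singletons-design {suc n} (suc i) (suc j) = cong₂ (λ b c → 𝟙ℕ (b ∧ lookup (⊥ {n}) j) + c) (lookup-⊥ i)
    (trans (count-map (both (suc i) (suc j)) (outside ∷_) (singletons n)) (singletons-design i j))

  copies-of-⊤ : ∀ {n} k (i j : Fin n) → count (both i j) (List.replicate k ⊤) ≡ k
  copies-of-⊤ zero    i j = refl
  copies-of-⊤ (suc k) i j = cong₂ (λ b c → 𝟙ℕ b + c)
    (cong₂ _∧_ (lookup-replicate i inside) (lookup-replicate j inside)) (copies-of-⊤ k i j)

  nonempty-size : ∀ n → All (λ B → 1 ≤ card B) (nonempty n)
  nonempty-size zero    = []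
  nonempty-size (suc n) = s≤s z≤n ∷ All.++⁺
    (All.map⁺ (nonempty-size n)) (All.map⁺ (All.map (λ _ → s≤s z≤n) (nonempty-size n)))

  singletons-size : ∀ n → All (λ B → 1 ≤ card B) (singletons n)
  singletons-size zero    = []
  singletons-size (suc n) = s≤s z≤n ∷ All.map⁺ (singletons-size n)

  -- The witness is the initial segment of `suc k` points. It is what makes every block valency from
  -- 1 to `v` occur.
  nonempty-of-size : ∀ {n} k → k < n → Σ[ B ∈ Subset n ] B ∈ nonempty n × card B ≡ suc k
  nonempty-of-size {suc n} zero    _ = ⁅ zero ⁆ , here refl , cong suc (∣⊥∣≡0 n)
  nonempty-of-size {suc n} (suc k) k<n =
    let B , B∈ , size≡k = nonempty-of-size k (s<s⁻¹ k<n) in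
    inside ∷ B ,
    there (∈-++⁺ʳ (List.map (outside ∷_) (nonempty n)) (∈-map⁺ (inside ∷_) B∈)) ,
    cong suc size≡k

  sum≡card : ∀ {n} (B : Subset n) → ℕΣ.sum (𝟙ℕ ∘ lookup B) ≡ card B
  sum≡card []            = refl
  sum≡card (inside  ∷ B) = cong suc (sum≡card B)
  sum≡card (outside ∷ B) = sum≡card B

  inhabited : ∀ {n} (B : Subset n) → 1 ≤ card B → ∃[ i ] lookup B i ≡ true
  inhabited (inside  ∷ B) _  = zero , refl
  inhabited (outside ∷ B) 1≤ = let i , Bi = inhabited B 1≤ in suc i , Bi

  -- Here d is r - λ and l is λ.  The nonempty subsets alone give d = l = m; repeating the
  -- singletons raises d and repeating ⊤ raises l until both quadratics split over ℤ.
  module Design (w : ℕ) where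
    v m : ℕ
    v = 2 + w
    m = 2 ^ w

    fulls points others blocks : List (Subset v)
    fulls  = List.replicate (2 * m + 2 * v) ⊤
    points = List.concat (List.replicate (m * m) (singletons v))
    others = fulls ++ nonempty v ++ points
    -- Two copies of `⊤` lead the list, so the equality of the first two blocks, needed for the
    -- eigenvalue 0, holds by definition.
    blocks = ⊤ ∷ ⊤ ∷ others

    b : ℕ
    b = length others

    mem : Fin (2 + b) → Fin v → Bool
    mem k i = lookup (List.lookup blocks k) i

    -- The values are chosen to factor: `d = m (m + 1)` gives the roots `m` and `-(m + 1)`, and
    -- `d + v l = (m + 2 v) (m + v + 1)` gives `m + 2 v` and `-(m + v + 1)`, whose sum is `v - 1`.
    d l : ℕ
    d = m + m * m
    l = 2 + (3 * m + 2 * v)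

    design : ∀ i j → ℕΣ.sum (λ k → 𝟙ℕ (mem k i ∧ mem k j)) ≡ (if does (i ≟ j) then d else 0) + l
    design i j = begin
      ℕΣ.sum (λ k → 𝟙ℕ (mem k i ∧ mem k j))
        ≡⟨ sum-lookup (both i j) blocks ⟩
      count (both i j) blocks
        ≡⟨ count-++ (both i j) (List.replicate 2 ⊤) others ⟩
      count (both i j) (List.replicate 2 ⊤) + count (both i j) others
        ≡⟨ cong₂ _+_ (copies-of-⊤ 2 i j) (count-++ (both i j) fulls _) ⟩
      2 + (count (both i j) fulls + count (both i j) (nonempty v ++ points))
        ≡⟨ cong₂ (λ x y → 2 + (x + y)) (copies-of-⊤ (2 * m + 2 * v) i j) (count-++ (both i j) (nonempty v) _) ⟩
      2 + (2 * m + 2 * v + (count (both i j) (nonempty v) + count (both i j) points))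
        ≡⟨ cong₂ (λ x y → 2 + (2 * m + 2 * v + (x + y))) (nonempty-design w i j)
             (trans (count-copies (both i j) (m * m) (singletons v)) (cong (m * m *_) (singletons-design i j))) ⟩
      2 + (2 * m + 2 * v + ((if does (i ≟ j) then m else 0) + m + m * m * 𝟙ℕ (does (i ≟ j))))
        ≡⟨ collect (does (i ≟ j)) m v ⟩
      (if does (i ≟ j) then d else 0) + l ∎
      where
      open ≡-Reasoning
      collect : ∀ q m v → 2 + (2 * m + 2 * v + ((if q then m else 0) + m + m * m * 𝟙ℕ q)) ≡
        (if q then m + m * m else 0) + (2 + (3 * m + 2 * v))
      collect true  = solve 2 (λ m v → con 2 :+ (con 2 :* m :+ con 2 :* v :+ (m :+ m :+ m :* m :* con 1))
        := (m :+ m :* m) :+ (con 2 :+ (con 3 :* m :+ con 2 :* v))) refl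
        where open +-*-Solver
      collect false = solve 2 (λ m v → con 2 :+ (con 2 :* m :+ con 2 :* v :+ (con 0 :+ m :+ m :* m :* con 0))
        := con 0 :+ (con 2 :+ (con 3 :* m :+ con 2 :* v))) refl
        where open +-*-Solver

    twins : ∀ i → mem zero i ≡ mem (suc zero) i
    twins i = refl

    block-size : ∀ k → 1 ≤ card (List.lookup blocks k)
    block-size k = All.lookup sizes (∈-lookup k)
      where
      ⊤-size : 1 ≤ card (⊤ {v})
      ⊤-size = s≤s z≤n
      sizes : All (λ B → 1 ≤ card B) blocks
      sizes = ⊤-size ∷ ⊤-size ∷ All.++⁺ (All.replicate⁺ (2 * m + 2 * v) ⊤-size)
        (All.++⁺ (nonempty-size v) (All.concat⁺ (All.replicate⁺ (m * m) (singletons-size v))))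

    block-of-size : ∀ (a : Fin v) → ∃[ k ] card (List.lookup blocks k) ≡ suc (toℕ a)
    block-of-size a =
      let B , B∈ , size≡ = nonempty-of-size (toℕ a) (Fin.toℕ<n a)
          B∈blocks : B ∈ blocks
          B∈blocks = there (there (∈-++⁺ʳ fulls (∈-++⁺ˡ B∈)))
      in Any.index B∈blocks ,
         trans (cong card (sym (Any.lookup-index B∈blocks))) size≡

-- The real numbers as a commutative ring.

open import Defs

<⇒≱ : ∀ {p q} → p ℚ.< q → ¬ q ℚ.≤ p
<⇒≱ p<q q≤p = ℚ.<-irrefl refl (ℚ.<-≤-trans p<q q≤p)

≗⇒≈ : ∀ x y → (∀ n → seq x n ≡ seq y n) → x ≈ y
≗⇒≈ x y eq ε 0<ε = 0 , λ n _ →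
  subst (λ p → ∣ p ∣ ℚ.< ε)
    (sym (trans (cong (ℚ._- seq y n) (eq n)) (ℚ.+-inverseʳ (seq y n)))) 0<ε

∣-∣-swap : ∀ p q → ∣ p ℚ.- q ∣ ≡ ∣ q ℚ.- p ∣
∣-∣-swap p q = trans (sym (ℚ.∣-p∣≡∣p∣ (p ℚ.- q))) (cong ∣_∣ (ℚ⁺.⁻¹-anti-homo‿- p q))

≈-refl : ∀ {x} → x ≈ x
≈-refl {x} = ≗⇒≈ x x λ _ → refl

≈-sym : ∀ {x y} → x ≈ y → y ≈ x
≈-sym {x} {y} x≈y ε 0<ε with x≈y ε 0<ε
... | N , close = N , λ n N≤n → subst (ℚ._< ε) (∣-∣-swap (seq x n) (seq y n)) (close n N≤n)

≈-trans : ∀ {x y z} → x ≈ y → y ≈ z → x ≈ z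
≈-trans {x} {y} {z} x≈y y≈z ε 0<ε
  with x≈y (½ ℚ.* ε) (½ε>0 0<ε) | y≈z (½ ℚ.* ε) (½ε>0 0<ε)
... | M , close₁ | N , close₂ = M ⊔ N , λ n ≤n →
  subst (λ p → ∣ p ∣ ℚ.< ε) (telescope (seq x n) (seq y n) (seq z n))
    (sum-small (seq x n ℚ.- seq y n) (seq y n ℚ.- seq z n) ε
      (close₁ n (ℕ.m⊔n≤o⇒m≤o M N ≤n)) (close₂ n (ℕ.m⊔n≤o⇒n≤o M N ≤n)))

+-cong : ∀ {x x′ y y′} → x ≈ x′ → y ≈ y′ → x + y ≈ x′ + y′
+-cong {x} {x′} {y} {y′} x≈x′ y≈y′ ε 0<ε
  with x≈x′ (½ ℚ.* ε) (½ε>0 0<ε) | y≈y′ (½ ℚ.* ε) (½ε>0 0<ε)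
... | M , close₁ | N , close₂ = M ⊔ N , λ n ≤n →
  subst (λ p → ∣ p ∣ ℚ.< ε) (sym (+-split (seq x n) (seq y n) (seq x′ n) (seq y′ n)))
    (sum-small (seq x n ℚ.- seq x′ n) (seq y n ℚ.- seq y′ n) ε
      (close₁ n (ℕ.m⊔n≤o⇒m≤o M N ≤n)) (close₂ n (ℕ.m⊔n≤o⇒n≤o M N ≤n)))

-- By `*-split` the difference is `x (y - y′) + y′ (x - x′)`. Since `x` and `y′` are eventually
-- bounded, each summand can be made smaller than half of `ε`.
*-cong : ∀ {x x′ y y′} → x ≈ x′ → y ≈ y′ → x * y ≈ x′ * y′
*-cong {x} {x′} {y} {y′} x≈x′ y≈y′ ε 0<ε =
  let K , K>0 , M₁ , x≤K = bounded (cauchy x)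
      L , L>0 , N₁ , y≤L = bounded (cauchy y′)
      M₂ , x-close = x≈x′ (((½ ℚ.* ε) /⁺ L) {{L>0}}) (/⁺>0 L {{L>0}} (½ε>0 0<ε))
      N₂ , y-close = y≈y′ (((½ ℚ.* ε) /⁺ K) {{K>0}}) (/⁺>0 K {{K>0}} (½ε>0 0<ε))
  in (M₁ ⊔ N₁) ⊔ (M₂ ⊔ N₂) , λ n ≤n →
    let ≤₁ = ℕ.m⊔n≤o⇒m≤o (M₁ ⊔ N₁) (M₂ ⊔ N₂) ≤n
        ≤₂ = ℕ.m⊔n≤o⇒n≤o (M₁ ⊔ N₁) (M₂ ⊔ N₂) ≤n
    in subst (λ p → ∣ p ∣ ℚ.< ε) (sym (*-split (seq x n) (seq y n) (seq x′ n) (seq y′ n)))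
      (sum-small (seq x n ℚ.* (seq y n ℚ.- seq y′ n)) (seq y′ n ℚ.* (seq x n ℚ.- seq x′ n)) ε
        (product-small K {{K>0}} (seq x n) (seq y n ℚ.- seq y′ n) (½ ℚ.* ε)
          (x≤K n (ℕ.m⊔n≤o⇒m≤o M₁ N₁ ≤₁)) (y-close n (ℕ.m⊔n≤o⇒n≤o M₂ N₂ ≤₂)))
        (product-small L {{L>0}} (seq y′ n) (seq x n ℚ.- seq x′ n) (½ ℚ.* ε)
          (y≤L n (ℕ.m⊔n≤o⇒n≤o M₁ N₁ ≤₁)) (x-close n (ℕ.m⊔n≤o⇒m≤o M₂ N₂ ≤₂))))

∣neg-∣ : ∀ p q → ∣ ℚ.- p ℚ.- ℚ.- q ∣ ≡ ∣ p ℚ.- q ∣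
∣neg-∣ p q = trans (cong ∣_∣ (sym (ℚ.neg-distrib-+ p (ℚ.- q)))) (ℚ.∣-p∣≡∣p∣ (p ℚ.- q))

infix 8 -_

-_ : ℝ → ℝ
- x = mkℝ (λ n → ℚ.- seq x n) λ ε 0<ε →
  let N , close = cauchy x ε 0<ε in
  N , λ m n N≤m N≤n → subst (ℚ._< ε) (sym (∣neg-∣ (seq x m) (seq x n))) (close m n N≤m N≤n)

-‿cong : ∀ {x y} → x ≈ y → - x ≈ - y
-‿cong {x} {y} x≈y ε 0<ε =
  let N , close = x≈y ε 0<ε in
  N , λ n N≤n → subst (ℚ._< ε) (sym (∣neg-∣ (seq x n) (seq y n))) (close n N≤n)

-- The ring identities hold term by term in ℚ. Implicit arguments are spelled out because `_≈_`
-- unfolds to a statement about sequences, from which the reals with their Cauchy proofs cannot be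
-- inferred.
ℝ-isCommutativeRing : IsCommutativeRing _≈_ _+_ _*_ -_ 0ℝ 1ℝ
ℝ-isCommutativeRing = record
  { isRing = record
    { +-isAbelianGroup = record
      { isGroup = record
        { isMonoid = record
          { isSemigroup = record
            { isMagma = record
              { isEquivalence = record
                { refl = λ {x} → ≈-refl {x}
                ; sym = λ {x} {y} → ≈-sym {x} {y}
                ; trans = λ {x} {y} {z} → ≈-trans {x} {y} {z} }
              ; ∙-cong = λ {x} {x′} {y} {y′} → +-cong {x} {x′} {y} {y′} }
            ; assoc = λ x y z → ≗⇒≈ (x + y + z) (x + (y + z)) λ n → ℚ.+-assoc (seq x n) (seq y n) (seq z n) }
          ; identity = (λ x → ≗⇒≈ (0ℝ + x) x λ n → ℚ.+-identityˡ (seq x n))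
                     , (λ x → ≗⇒≈ (x + 0ℝ) x λ n → ℚ.+-identityʳ (seq x n)) }
        ; inverse = (λ x → ≗⇒≈ (- x + x) 0ℝ λ n → ℚ.+-inverseˡ (seq x n))
                  , (λ x → ≗⇒≈ (x + - x) 0ℝ λ n → ℚ.+-inverseʳ (seq x n))
        ; ⁻¹-cong = λ {x} {y} → -‿cong {x} {y} }
      ; comm = λ x y → ≗⇒≈ (x + y) (y + x) λ n → ℚ.+-comm (seq x n) (seq y n) }
    ; *-cong = λ {x} {x′} {y} {y′} → *-cong {x} {x′} {y} {y′}
    ; *-assoc = λ x y z → ≗⇒≈ (x * y * z) (x * (y * z)) λ n → ℚ.*-assoc (seq x n) (seq y n) (seq z n)
    ; *-identity = (λ x → ≗⇒≈ (1ℝ * x) x λ n → ℚ.*-identityˡ (seq x n))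
                 , (λ x → ≗⇒≈ (x * 1ℝ) x λ n → ℚ.*-identityʳ (seq x n))
    ; distrib = (λ x y z → ≗⇒≈ (x * (y + z)) (x * y + x * z) λ n → ℚ.*-distribˡ-+ (seq x n) (seq y n) (seq z n))
              , (λ x y z → ≗⇒≈ ((y + z) * x) (y * x + z * x) λ n → ℚ.*-distribʳ-+ (seq x n) (seq y n) (seq z n)) }
  ; *-comm = λ x y → ≗⇒≈ (x * y) (y * x) λ n → ℚ.*-comm (seq x n) (seq y n) }

ℝ-commutativeRing : CommutativeRing 0ℓ 0ℓ
ℝ-commutativeRing = record { isCommutativeRing = ℝ-isCommutativeRing }

-- Apartness from zero, and cancellation.

Apart₀ : (ℕ → ℚ) → Set
Apart₀ x = Σ[ ε ∈ ℚ ] 0ℚ ℚ.< ε × ∃[ N ] (∀ n → N ℕ.≤ n → ε ℚ.≤ ∣ x n ∣)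

p-0≡p : ∀ p → p ℚ.- 0ℚ ≡ p
p-0≡p = ℚ.+-identityʳ

≈0⇒¬apart : ∀ x → x ≈ 0ℝ → ¬ Apart₀ (seq x)
≈0⇒¬apart x x≈0 (ε , 0<ε , N , far) with x≈0 ε 0<ε
... | M , near = <⇒≱
  (subst (λ p → ∣ p ∣ ℚ.< ε) (p-0≡p _) (near (M ⊔ N) (ℕ.m≤m⊔n M N)))
  (far (M ⊔ N) (ℕ.m≤n⊔m M N))

-- Beyond `N` the terms differ by less than half of `ε`. A single term of absolute value at least
-- `ε` there would keep all terms beyond `N` at least half of `ε` from zero, which is apartness; the
-- order on ℚ is decidable, so the contradiction yields the bound.
¬apart⇒≈0 : ∀ x → ¬ Apart₀ (seq x) → x ≈ 0ℝ
¬apart⇒≈0 x ¬apart ε 0<ε with cauchy x (½ ℚ.* ε) (½ε>0 0<ε)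
... | N , close = N , λ n N≤n →
  subst (λ p → ∣ p ∣ ℚ.< ε) (sym (p-0≡p (seq x n)))
    (ℚ.≰⇒> λ ε≤ → ¬apart (½ ℚ.* ε , ½ε>0 0<ε , N , λ m N≤m →
      ℚ.≮⇒≥ λ xm< → <⇒≱
        (subst (λ p → ∣ p ∣ ℚ.< ε) (ℚ⁺.//-rightDividesˡ (seq x m) (seq x n))
          (sum-small (seq x n ℚ.- seq x m) (seq x m) ε (close n m N≤n N≤m) xm<))
        ε≤))

-- Vanishing is equivalent to the negation of `Apart₀`, and negations are stable.
≈0-stable : ∀ x → ¬ ¬ (x ≈ 0ℝ) → x ≈ 0ℝ
≈0-stable x ¬¬x≈0 = ¬apart⇒≈0 x λ apart → ¬¬x≈0 λ x≈0 → ≈0⇒¬apart x x≈0 apart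

-- If `x` stays at least `δ` from zero, a late term of `y` of size at least `ε` would make the
-- product at least `δ ε`.
apart-cancel : ∀ x y → Apart₀ (seq x) → x * y ≈ 0ℝ → y ≈ 0ℝ
apart-cancel x y (δ , 0<δ , M , far) xy≈0 ε 0<ε
  with xy≈0 (δ ℚ.* ε) (ℚ.positive⁻¹ _ {{ℚ.pos*pos⇒pos δ {{ℚ.positive 0<δ}} ε {{ℚ.positive 0<ε}}}})
... | N , near = M ⊔ N , λ n ≤n → ℚ.≰⇒> λ ε≤ → <⇒≱
  (subst (ℚ._< δ ℚ.* ε)
    (trans (cong ∣_∣ (p-0≡p (seq x n ℚ.* seq y n))) (ℚ.∣p*q∣≡∣p∣*∣q∣ (seq x n) (seq y n)))
    (near n (ℕ.m⊔n≤o⇒n≤o M N ≤n)))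
  (ℚ.≤-trans
    (ℚ.*-monoʳ-≤-nonNeg ε {{ℚ.nonNegative (ℚ.<⇒≤ 0<ε)}} (far n (ℕ.m⊔n≤o⇒m≤o M N ≤n)))
    (ℚ.*-monoˡ-≤-nonNeg ∣ seq x n ∣ {{ℚ.∣-∣-nonNeg (seq x n)}}
      (subst (λ p → ε ℚ.≤ ∣ p ∣) (p-0≡p (seq y n)) ε≤)))

-- From `x ≉ 0` only the double negation of apartness follows; that suffices because the conclusion
-- is stable.
≉0-cancel : ∀ x y → ¬ (x ≈ 0ℝ) → x * y ≈ 0ℝ → y ≈ 0ℝ
≉0-cancel x y x≉0 xy≈0 = ≈0-stable y λ y≉0 →
  x≉0 (¬apart⇒≈0 x λ apart → y≉0 (apart-cancel x y apart xy≈0))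

∣p-q∣>0 : ∀ {p q} → p ≢ q → 0ℚ ℚ.< ∣ p ℚ.- q ∣
∣p-q∣>0 {p} {q} p≢q = ℚ.≰⇒> λ ∣p-q∣≤0 → p≢q (ℚ⁺.x∙y⁻¹≈ε⇒x≈y p q
  (ℚ.∣p∣≡0⇒p≡0 (p ℚ.- q) (ℚ.≤-antisym ∣p-q∣≤0 (ℚ.0≤∣p∣ (p ℚ.- q)))))

apart-from-one : ∀ x {p q} → p ≢ q →
  Apart₀ (λ n → seq x n ℚ.- p) ⊎ Apart₀ (λ n → seq x n ℚ.- q)
apart-from-one x {p} {q} p≢q = split (cauchy x η 0<η)
  where
  δ η : ℚ
  δ = ∣ p ℚ.- q ∣
  -- One term of `x`, tested against `p` with tolerance `δ / 2`, decides the case: it is far from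
  -- `p`, or near `p` and hence far from `q`. The Cauchy error and the remaining distance then share
  -- that half as two quarters.
  η = ½ ℚ.* (½ ℚ.* δ)

  0<δ : 0ℚ ℚ.< δ
  0<δ = ∣p-q∣>0 p≢q

  0<η : 0ℚ ℚ.< η
  0<η = ½ε>0 (½ε>0 0<δ)

  split : ∃[ N ] (∀ m n → N ℕ.≤ m → N ℕ.≤ n → ∣ seq x m ℚ.- seq x n ∣ ℚ.< η) →
    Apart₀ (λ n → seq x n ℚ.- p) ⊎ Apart₀ (λ n → seq x n ℚ.- q)
  split (N , close) with ∣ seq x N ℚ.- p ∣ ℚ.<? ½ ℚ.* δ
  ... | no ≮ = inj₁ (η , 0<η , N , λ n N≤n → ℚ.≮⇒≥ λ near → ≮
    (subst (λ r → ∣ r ∣ ℚ.< ½ ℚ.* δ) (telescope (seq x N) (seq x n) p)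
      (sum-small (seq x N ℚ.- seq x n) (seq x n ℚ.- p) (½ ℚ.* δ) (close N n ℕ.≤-refl N≤n) near)))
  ... | yes near-p = inj₂ (η , 0<η , N , λ n N≤n → ℚ.≮⇒≥ λ near → ℚ.<-irrefl refl
    (subst (λ r → ∣ r ∣ ℚ.< δ) (telescope p (seq x N) q)
      (sum-small (p ℚ.- seq x N) (seq x N ℚ.- q) δ
        (subst (ℚ._< ½ ℚ.* δ) (∣-∣-swap (seq x N) p) near-p)
        (subst (λ r → ∣ r ∣ ℚ.< ½ ℚ.* δ) (telescope (seq x N) (seq x n) q)
          (sum-small (seq x N ℚ.- seq x n) (seq x n ℚ.- q) (½ ℚ.* δ)
            (close N n ℕ.≤-refl N≤n) near)))))

-- The integers inside the reals.

fromℚ-injective : ∀ {p q} → fromℚ p ≈ fromℚ q → p ≡ q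
fromℚ-injective {p} {q} p≈q with p ℚ.≟ q
... | yes p≡q = p≡q
... | no  p≢q = let N , close = p≈q ∣ p ℚ.- q ∣ (∣p-q∣>0 p≢q) in
  ⊥-elim (ℚ.<-irrefl refl (close N ℕ.≤-refl))

-- Built directly with `mkℚ`, so that the numerator is `i` by definition and injectivity follows by
-- projection.
toℚ : ℤ → ℚ
toℚ i = mkℚ i 0 (Coprimality.sym (Coprimality.1-coprimeTo ℤ.∣ i ∣))

toℚ-+ : ∀ i j → toℚ (i ℤ.+ j) ≡ toℚ i ℚ.+ toℚ j
toℚ-+ i j = ℚ.toℚᵘ-injective (ℚᵘ.≃-trans
  (ℚᵘ.*≡* (cong (ℤ._* 1ℤ) (sym (cong₂ ℤ._+_ (ℤ.*-identityʳ i) (ℤ.*-identityʳ j)))))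
  (ℚᵘ.≃-sym (ℚ.toℚᵘ-homo-+ (toℚ i) (toℚ j))))

toℚ-* : ∀ i j → toℚ (i ℤ.* j) ≡ toℚ i ℚ.* toℚ j
toℚ-* i j = ℚ.toℚᵘ-injective (ℚᵘ.≃-trans (ℚᵘ.*≡* refl)
  (ℚᵘ.≃-sym (ℚ.toℚᵘ-homo-* (toℚ i) (toℚ j))))

toℚ-neg : ∀ i → toℚ (ℤ.- i) ≡ ℚ.- toℚ i
toℚ-neg i = ℚ.toℚᵘ-injective (ℚᵘ.≃-trans (ℚᵘ.*≡* refl)
  (ℚᵘ.≃-sym (ℚ.toℚᵘ-homo‿- (toℚ i))))

ι : ℤ → ℝ
ι i = fromℚ (toℚ i)

ι-injective : Injective _≡_ _≈_ ι
ι-injective {i} {j} ιi≈ιj = cong ℚ.↥_ (fromℚ-injective {toℚ i} {toℚ j} ιi≈ιj)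

ℤ⟶ℝ : ℤ.+-*-rawRing -Raw-AlmostCommutative⟶ fromCommutativeRing ℝ-commutativeRing
ℤ⟶ℝ = record
  { ⟦_⟧    = ι
  ; +-homo = λ i j → ≗⇒≈ (ι (i ℤ.+ j)) (ι i + ι j) λ _ → toℚ-+ i j
  ; *-homo = λ i j → ≗⇒≈ (ι (i ℤ.* j)) (ι i * ι j) λ _ → toℚ-* i j
  ; -‿homo = λ i → ≗⇒≈ (ι (ℤ.- i)) (- ι i) λ _ → toℚ-neg i
  ; 0-homo = ≈-refl {0ℝ}
  ; 1-homo = ≈-refl {1ℝ}
  }

open SpectralAlgebra ℝ-commutativeRing ℤ⟶ℝ
  using (factors; HasEigenvector; Annihilates; integral-eigenvector; shifts-annihilate;
         module BlockGraph; spectrum-eigenvectors)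

-- Locating a real root among given integers.

factors-cancel : ∀ {k} (θ : Fin k → ℤ) μ y → (∀ i → ¬ (μ + - ι (θ i) ≈ 0ℝ)) →
  factors θ μ y ≈ 0ℝ → y ≈ 0ℝ
factors-cancel {ℕ.zero}  θ μ y μ≉θ y≈0 = y≈0
factors-cancel {ℕ.suc k} θ μ y μ≉θ eq = factors-cancel (θ ∘ suc) μ y (μ≉θ ∘ suc)
  (≉0-cancel (μ + - ι (θ zero)) (factors (θ ∘ suc) μ y) (μ≉θ zero) eq)

-- `Apart₀` takes bare sequences, so the difference needs no Cauchy proof here.
AwayFrom : ℝ → ℤ → Set
AwayFrom μ t = Apart₀ (λ n → seq μ n ℚ.- toℚ t)

-- The candidate from the tail is compared with the head; since these differ, `apart-from-one`
-- excludes one of the two and the other goes on as candidate. The result is merely the value not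
-- excluded, not one proved to minimise a distance.
nearest : ∀ {k} (θ : Fin (ℕ.suc k) → ℤ) → Injective _≡_ _≡_ θ → ∀ μ →
  ∃[ i ] (∀ j → j ≢ i → AwayFrom μ (θ j))
nearest {ℕ.zero}  θ inj μ = zero , λ { zero 0≢0 → ⊥-elim (0≢0 refl) }
nearest {ℕ.suc k} θ inj μ =
  let i , away = nearest (θ ∘ suc) (Fin.suc-injective ∘ inj) μ in
  compare i away (apart-from-one μ {toℚ (θ zero)} {toℚ (θ (suc i))} λ eq →
    Fin.0≢1+n (inj {zero} {suc i} (cong ℚ.↥_ eq)))
  where
  compare : ∀ i → (∀ j → j ≢ i → AwayFrom μ (θ (suc j))) →
    AwayFrom μ (θ zero) ⊎ AwayFrom μ (θ (suc i)) →
    ∃[ i ] (∀ j → j ≢ i → AwayFrom μ (θ j))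
  compare i away (inj₁ away₀) = suc i , λ
    { zero    _   → away₀
    ; (suc j) j≢i → away j (j≢i ∘ cong suc) }
  compare i away (inj₂ awayᵢ) = zero , λ
    { zero    0≢0 → ⊥-elim (0≢0 refl)
    ; (suc j) _   → away-suc j }
    where
    away-suc : ∀ j → AwayFrom μ (θ (suc j))
    away-suc j with j Fin.≟ i
    ... | yes refl = awayᵢ
    ... | no  j≢i  = away j j≢i

-- All factors except the one for the candidate `i` are apart from zero. Were that factor nonzero
-- too, all could be cancelled and `w` would vanish; stability turns this refutation into equality.
root-of-factors : ∀ {k n} (θ : Fin k → ℤ) → Injective _≡_ _≡_ θ → ∀ μ (w : Fin n → ℝ) →
  ¬ (∀ j → w j ≈ 0ℝ) → (∀ j → factors θ μ (w j) ≈ 0ℝ) → ∃[ i ] μ ≈ ι (θ i)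
root-of-factors {ℕ.zero}  θ inj μ w w≉0 vanish = ⊥-elim (w≉0 vanish)
root-of-factors {ℕ.suc k} θ inj μ w w≉0 vanish with nearest θ inj μ
... | i , apart = i , GroupProperties.x∙y⁻¹≈ε⇒x≈y (CommutativeRing.+-group ℝ-commutativeRing) μ (ι (θ i))
  (≈0-stable (μ + - ι (θ i)) λ μ≉θᵢ → w≉0 λ j → factors-cancel θ μ (w j) (μ≉ μ≉θᵢ) (vanish j))
  where
  μ≉ : ¬ (μ + - ι (θ i) ≈ 0ℝ) → ∀ j → ¬ (μ + - ι (θ j) ≈ 0ℝ)
  μ≉ μ≉θᵢ j with j Fin.≟ i
  ... | yes refl = μ≉θᵢ
  ... | no  j≢i  = λ μ≈θⱼ → ≈0⇒¬apart (μ + - ι (θ j)) μ≈θⱼ (apart j j≢i)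

-- Graphs from Boolean adjacency functions.

module _ {n} (adj : Fin n → Fin n → Bool)
  (adj-sym : ∀ i j → adj i j ≡ adj j i) (adj-irrefl : ∀ i → adj i i ≡ false) where

  fromAdjacency : Graph n
  fromAdjacency = record
    { _~_   = λ i j → T (adj i j)
    ; _~?_  = λ i j → T? (adj i j)
    ; ~-sym = λ {i} {j} → subst T (adj-sym i j)
    ; ~-irr = λ { {i} refl → subst T (adj-irrefl i) }
    }

  exactly-spectrum : ∀ {k} (θ : Fin k → ℤ) → Injective _≡_ _≡_ θ →
    (∀ i → HasEigenvector adj (θ i)) → Annihilates θ adj →
    Exactly k _≈_ (IsEigenvalue (Graph.adjacencyMatrix fromAdjacency))
  exactly-spectrum θ inj eigenvectors annihilates =
    ι ∘ θ , (λ {i} {j} eq → inj (ι-injective {θ i} {θ j} eq)) , attained , only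
    where
    attained : ∀ i → IsEigenvalue (Graph.adjacencyMatrix fromAdjacency) (ι (θ i))
    attained i with eigenvectors i
    -- `does (T? b)` reduces to `b`, so `IsEigenvector` is the eigenvalue equation of the adjacency
    -- matrix by definition and `eig` is passed on unchanged.
    ... | w , eig , j , z , z≢0 , wⱼ≈z = w ,
      (λ w≈0 → z≢0 (ι-injective {z} {0ℤ} (≈-trans {ι z} {w j} {0ℝ} (≈-sym {w j} {ι z} wⱼ≈z) (w≈0 j)))) ,
      eig

    only : ∀ μ → IsEigenvalue (Graph.adjacencyMatrix fromAdjacency) μ → ∃[ i ] μ ≈ ι (θ i)
    only μ (w , w≉0 , eig) = root-of-factors θ inj μ w w≉0 (annihilates μ w eig)

Realisable : ℕ → Set₁
Realisable t = ∃[ n ] Σ[ G ∈ Graph n ]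
      Graph.Connected G
      × ¬ Graph.Bipartite G
      × Exactly 5 _≈_ (IsEigenvalue (Graph.adjacencyMatrix G))
      × Exactly t _≡_ (Graph.IsValency G)

triangle⇒¬bipartite : ∀ {n} (G : Graph n) → let open Graph G in
  ∀ {i j k} → i ~ j → j ~ k → i ~ k → ¬ Bipartite
triangle⇒¬bipartite G {i} {j} {k} i~j j~k i~k (colour , proper) =
  clash (colour i) (colour j) (colour k) (proper i~j) (proper j~k) (proper i~k)
  where
  clash : ∀ a b c → a ≢ b → b ≢ c → ¬ a ≢ c
  clash a b c a≢b b≢c a≢c = a≢c (trans (Bool.¬-not a≢b) (sym (Bool.¬-not (b≢c ∘ sym))))

-- Certificates checked by computation, for t ≤ 2.

valency : ∀ {n} → (Fin n → Fin n → Bool) → Fin n → ℕ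
valency adj i = length (filter (λ j → T? (adj i j)) (allFin _))

-- Every quantifier ranges over a finite set, so the whole is decidable. To this end connectedness
-- is witnessed by walks of length two, non-bipartiteness by a triangle, and the eigenvectors are
-- integral.
Certificate : ∀ {n k t} → (Fin n → Fin n → Bool) → (Fin k → ℤ) → (Fin k → Fin n → ℤ) → (Fin t → ℕ) → Set
Certificate {n} adj θ z f =
  ((∀ i j → adj i j ≡ adj j i) × (∀ i → adj i i ≡ false))
  × (∀ i j → ∃[ k ] T (adj i k) × T (adj k j))
  × (∃[ i ] ∃[ j ] ∃[ k ] T (adj i j) × T (adj j k) × T (adj i k))
  × (∀ i j → θ i ≡ θ j → i ≡ j)
  × (∀ i → shifts adj θ (basis i) ≡ Vec.replicate n 0ℤ)
  × (∀ a → (∀ i → ℤΣ.sum (λ j → 𝟙ℤ (adj i j) ℤ.* z a j) ≡ θ a ℤ.* z a i) × (∃[ j ] z a j ≢ 0ℤ))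
  × (∀ a c → f a ≡ f c → a ≡ c)
  × (∀ a → ∃[ i ] valency adj i ≡ f a)
  × (∀ i → ∃[ a ] valency adj i ≡ f a)

certificate? : ∀ {n k t} adj θ z f → Dec (Certificate {n} {k} {t} adj θ z f)
certificate? {n} adj θ z f =
  (all? (λ i → all? λ j → adj i j Bool.≟ adj j i) ×-dec all? (λ i → adj i i Bool.≟ false))
  ×-dec all? (λ i → all? λ j → any? λ k → T? (adj i k) ×-dec T? (adj k j))
  ×-dec any? (λ i → any? λ j → any? λ k → T? (adj i j) ×-dec T? (adj j k) ×-dec T? (adj i k))
  ×-dec all? (λ i → all? λ j → (θ i ℤ.≟ θ j) →-dec (i Fin.≟ j))
  ×-dec all? (λ i → ≡-dec ℤ._≟_ (shifts adj θ (basis i)) (Vec.replicate n 0ℤ))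
  ×-dec all? (λ a →
    all? (λ i → ℤΣ.sum (λ j → 𝟙ℤ (adj i j) ℤ.* z a j) ℤ.≟ θ a ℤ.* z a i)
    ×-dec any? (λ j → ¬? (z a j ℤ.≟ 0ℤ)))
  ×-dec all? (λ a → all? λ c → (f a ℕ.≟ f c) →-dec (a Fin.≟ c))
  ×-dec all? (λ a → any? λ i → valency adj i ℕ.≟ f a)
  ×-dec all? (λ i → any? λ a → valency adj i ℕ.≟ f a)

certified : ∀ {n t} adj θ z f → Certificate {n} {5} {t} adj θ z f → Realisable t
certified adj θ z f ((adj-sym , adj-irrefl) , two-step , (i , j , k , ij , jk , ik) ,
                     θ-inj , vanish , eigen , f-inj , attained , covered) =
  _ , G , connected , triangle⇒¬bipartite G {i} {j} {k} ij jk ik ,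
  exactly-spectrum adj adj-sym adj-irrefl θ (λ {a} {c} → θ-inj a c)
    (λ a → let eq , j , z≢0 = eigen a in
      ι ∘ z a , integral-eigenvector adj (θ a) (z a) eq , j , z a j , z≢0 , ≈-refl {ι (z a j)})
    (shifts-annihilate θ adj vanish) ,
  f , (λ {a} {c} → f-inj a c) , attained ,
  λ { _ (i , refl) → covered i }
  where
  G = fromAdjacency adj adj-sym adj-irrefl

  connected : Graph.Connected G
  connected i j = let k , i~k , k~j = two-step i j in i~k ◅ k~j ◅ Star.ε

-- The join of two triangular prisms, one on the even and one on the odd residues modulo 12.
one-valency : Realisable 1
one-valency = certified adj θ z f (from-yes (certificate? adj θ z f))
  where
  adj : Fin 12 → Fin 12 → Bool
  adj i j = not ((d ≡ᵇ 0) ∨ (d ≡ᵇ 2) ∨ (d ≡ᵇ 10))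
    where d = ℕ.∣ toℕ i - toℕ j ∣

  θ : Fin 5 → ℤ
  -- A prism has the eigenvalues 3, 1, 0 and -2. Vectors of sum zero on one prism keep theirs in the
  -- join, while 3 is replaced by 3 + 6 and 3 - 6.
  θ = lookup (+ 9 ∷ + 1 ∷ + 0 ∷ -[1+ 1 ] ∷ -[1+ 2 ] ∷ [])

  z : Fin 5 → Fin 12 → ℤ
  z = lookup ∘ lookup
    ( (p ∷ p ∷ p ∷ p ∷ p ∷ p ∷ p ∷ p ∷ p ∷ p ∷ p ∷ p ∷ [])
    ∷ (p ∷ o ∷ m ∷ o ∷ p ∷ o ∷ m ∷ o ∷ p ∷ o ∷ m ∷ o ∷ [])
    ∷ (p ∷ o ∷ m ∷ o ∷ o ∷ o ∷ p ∷ o ∷ m ∷ o ∷ o ∷ o ∷ [])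
    ∷ (p ∷ o ∷ p ∷ o ∷ o ∷ o ∷ m ∷ o ∷ m ∷ o ∷ o ∷ o ∷ [])
    ∷ (p ∷ m ∷ p ∷ m ∷ p ∷ m ∷ p ∷ m ∷ p ∷ m ∷ p ∷ m ∷ []) ∷ [])
    where
    p = 1ℤ
    o = 0ℤ
    m = -1ℤ

  f : Fin 1 → ℕ
  f _ = 9

-- The join of the three disjoint edges {0,3}, {1,4}, {2,5} and the two isolated vertices 6, 7.
two-valencies : Realisable 2
two-valencies = certified adj θ z f (from-yes (certificate? adj θ z f))
  where
  join : Fin 6 ⊎ Fin 2 → Fin 6 ⊎ Fin 2 → Bool
  join (inj₁ i) (inj₁ j) = ℕ.∣ toℕ i - toℕ j ∣ ≡ᵇ 3
  join (inj₁ _) (inj₂ _) = true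
  join (inj₂ _) (inj₁ _) = true
  join (inj₂ _) (inj₂ _) = false

  adj : Fin 8 → Fin 8 → Bool
  adj i j = join (splitAt 6 i) (splitAt 6 j)

  θ : Fin 5 → ℤ
  -- Vectors of sum zero on one part give 1, -1 and 0. The values 4 and -3 are those of the quotient
  -- matrix with rows (1, 2) and (6, 0).
  θ = lookup (+ 4 ∷ + 1 ∷ + 0 ∷ -[1+ 0 ] ∷ -[1+ 2 ] ∷ [])

  z : Fin 5 → Fin 8 → ℤ
  z = lookup ∘ lookup
    ( (+ 2 ∷ + 2 ∷ + 2 ∷ + 2 ∷ + 2 ∷ + 2 ∷ + 3 ∷ + 3 ∷ [])
    ∷ (1ℤ ∷ -1ℤ ∷ 0ℤ ∷ 1ℤ ∷ -1ℤ ∷ 0ℤ ∷ 0ℤ ∷ 0ℤ ∷ [])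
    ∷ (0ℤ ∷ 0ℤ ∷ 0ℤ ∷ 0ℤ ∷ 0ℤ ∷ 0ℤ ∷ 1ℤ ∷ -1ℤ ∷ [])
    ∷ (1ℤ ∷ 0ℤ ∷ 0ℤ ∷ -1ℤ ∷ 0ℤ ∷ 0ℤ ∷ 0ℤ ∷ 0ℤ ∷ [])
    ∷ (1ℤ ∷ 1ℤ ∷ 1ℤ ∷ 1ℤ ∷ 1ℤ ∷ 1ℤ ∷ -[1+ 1 ] ∷ -[1+ 1 ] ∷ []) ∷ [])

  f : Fin 2 → ℕ
  f 0F = 3
  f 1F = 6

-- Degrees, connectedness and triangles in the clique with blocks.

length-filter-tabulate : ∀ {a} {A : Set a} {n} (p : A → Bool) (g : Fin n → A) →
  length (filter (λ x → T? (p x)) (List.tabulate g)) ≡ ℕΣ.sum (𝟙ℕ ∘ p ∘ g)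
length-filter-tabulate {n = zero}  p g = refl
length-filter-tabulate {n = suc n} p g with p (g zero)
... | true  = cong suc (length-filter-tabulate p (g ∘ suc))
... | false = length-filter-tabulate p (g ∘ suc)

sum-ones : ∀ n → ℕΣ.sum {n} (λ _ → 1) ≡ n
sum-ones zero    = refl
sum-ones (suc n) = cong suc (sum-ones n)

sum-others : ∀ {n} (i : Fin (suc n)) → ℕΣ.sum (λ j → 𝟙ℕ (not (does (i Fin.≟ j)))) ≡ n
sum-others {n}     zero    = sum-ones n
sum-others {suc n} (suc i) = cong suc (sum-others i)

module _ {v b} (mem : Fin b → Fin v → Bool) where

  private adj = cliqueWithBlocks mem

  cliqueWithBlocks⊎-sym : ∀ s t → cliqueWithBlocks⊎ mem s t ≡ cliqueWithBlocks⊎ mem t s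
  cliqueWithBlocks⊎-sym (inj₁ i) (inj₁ j) with i Fin.≟ j
  ... | yes refl = cong not (sym (dec-true (i Fin.≟ i) refl))
  ... | no  i≢j  = cong not (sym (dec-false (j Fin.≟ i) (i≢j ∘ sym)))
  cliqueWithBlocks⊎-sym (inj₁ i) (inj₂ k) = refl
  cliqueWithBlocks⊎-sym (inj₂ k) (inj₁ i) = refl
  cliqueWithBlocks⊎-sym (inj₂ k) (inj₂ l) = refl

  cliqueWithBlocks⊎-irrefl : ∀ s → cliqueWithBlocks⊎ mem s s ≡ false
  cliqueWithBlocks⊎-irrefl (inj₁ i) = cong not (dec-true (i Fin.≟ i) refl)
  cliqueWithBlocks⊎-irrefl (inj₂ k) = refl

  blockGraph-sym : ∀ i j → adj i j ≡ adj j i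
  blockGraph-sym i j = cliqueWithBlocks⊎-sym (splitAt v i) (splitAt v j)

  blockGraph-irrefl : ∀ i → adj i i ≡ false
  blockGraph-irrefl i = cliqueWithBlocks⊎-irrefl (splitAt v i)

  blockGraph : Graph (v ℕ.+ b)
  blockGraph = fromAdjacency adj blockGraph-sym blockGraph-irrefl

  open Graph blockGraph

  degree-split : ∀ i → degree i ≡
    ℕΣ.sum (λ j → 𝟙ℕ (adj i (j ↑ˡ b))) ℕ.+ ℕΣ.sum (λ k → 𝟙ℕ (adj i (v ↑ʳ k)))
  degree-split i = trans (length-filter-tabulate (adj i) id)
    (sum-splitAt ℕ.+-0-commutativeMonoid v (𝟙ℕ ∘ adj i))

  degree-point : ∀ i → degree (i ↑ˡ b) ≡
    ℕΣ.sum (λ j → 𝟙ℕ (not (does (i Fin.≟ j)))) ℕ.+ ℕΣ.sum (λ k → 𝟙ℕ (mem k i))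
  degree-point i = trans (degree-split (i ↑ˡ b)) (cong₂ ℕ._+_
    (ℕΣ.sum-cong-≗ λ j → cong 𝟙ℕ (adj-↑ˡ-↑ˡ mem i j))
    (ℕΣ.sum-cong-≗ λ k → cong 𝟙ℕ (adj-↑ˡ-↑ʳ mem i k)))

  degree-block : ∀ k → degree (v ↑ʳ k) ≡ ℕΣ.sum (𝟙ℕ ∘ mem k)
  degree-block k = begin
    degree (v ↑ʳ k)
      ≡⟨ degree-split (v ↑ʳ k) ⟩
    ℕΣ.sum (λ j → 𝟙ℕ (adj (v ↑ʳ k) (j ↑ˡ b))) ℕ.+ ℕΣ.sum (λ l → 𝟙ℕ (adj (v ↑ʳ k) (v ↑ʳ l)))
      ≡⟨ cong₂ ℕ._+_
           (ℕΣ.sum-cong-≗ λ j → cong 𝟙ℕ (adj-↑ʳ-↑ˡ mem k j))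
           (ℕΣ.sum-cong-≗ λ l → cong 𝟙ℕ (adj-↑ʳ-↑ʳ mem k l)) ⟩
    ℕΣ.sum (𝟙ℕ ∘ mem k) ℕ.+ ℕΣ.sum {b} (λ _ → 0)
      ≡⟨ cong (ℕΣ.sum (𝟙ℕ ∘ mem k) ℕ.+_) (ℕΣ.sum-replicate-zero b) ⟩
    ℕΣ.sum (𝟙ℕ ∘ mem k) ℕ.+ 0
      ≡⟨ ℕ.+-identityʳ _ ⟩
    ℕΣ.sum (𝟙ℕ ∘ mem k) ∎
    where open ≡-Reasoning

  point~point : ∀ {i j} → i ≢ j → (i ↑ˡ b) ~ (j ↑ˡ b)
  point~point {i} {j} i≢j = subst T
    (sym (trans (adj-↑ˡ-↑ˡ mem i j) (cong not (dec-false (i Fin.≟ j) i≢j)))) tt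

  point~block : ∀ {i k} → mem k i ≡ true → (i ↑ˡ b) ~ (v ↑ʳ k)
  point~block {i} {k} i∈k = subst T (sym (trans (adj-↑ˡ-↑ʳ mem i k) i∈k)) tt

  block~point : ∀ {i k} → mem k i ≡ true → (v ↑ʳ k) ~ (i ↑ˡ b)
  block~point {i} {k} i∈k = ~-sym {i ↑ˡ b} {v ↑ʳ k} (point~block i∈k)

  -- The points form a clique and every block has a point, so each vertex reaches the point `c`.
  blockGraph-connected : Fin v → (∀ k → ∃[ i ] mem k i ≡ true) → Connected
  blockGraph-connected c inhabited i j =
    to-centre i ◅◅ Star.reverse (λ {x} {y} → ~-sym {x} {y}) (to-centre j)
    where
    point-to-centre : ∀ i → Star _~_ (i ↑ˡ b) (c ↑ˡ b)
    point-to-centre i with i Fin.≟ c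
    ... | yes refl = Star.ε
    ... | no  i≢c  = point~point i≢c ◅ Star.ε

    to-centre : ∀ i → Star _~_ i (c ↑ˡ b)
    to-centre = splitAt-elim v (λ i → Star _~_ i (c ↑ˡ b)) point-to-centre λ k →
      let i , i∈k = inhabited k in block~point i∈k ◅ point-to-centre i

  blockGraph-nonbipartite : ∀ {i j k} → i ≢ j → mem k i ≡ true → mem k j ≡ true → ¬ Bipartite
  blockGraph-nonbipartite {i} {j} {k} i≢j i∈k j∈k =
    triangle⇒¬bipartite blockGraph {i ↑ˡ b} {j ↑ˡ b} {v ↑ʳ k}
      (point~point i≢j) (point~block j∈k) (point~block i∈k)

-- The graphs for t ≥ 3.

spectrum-unique : ∀ {p q r s} → 0 < p → p < q → r < s →
  Injective _≡_ _≡_ (spectrum (+ p) -[1+ r ] (+ q) -[1+ s ])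
spectrum-unique 0<p p<q r<s {i} {j} = lookup-injective
  ( ((ℕ.<⇒≢ 0<p ∘ ℤ.+-injective) ∷ (λ ()) ∷ (ℕ.<⇒≢ (ℕ.<-trans 0<p p<q) ∘ ℤ.+-injective) ∷ (λ ()) ∷ [])
  ∷ ((λ ()) ∷ (ℕ.<⇒≢ p<q ∘ ℤ.+-injective) ∷ (λ ()) ∷ [])
  ∷ ((λ ()) ∷ (ℕ.<⇒≢ r<s ∘ ℤ.-[1+-injective) ∷ [])
  ∷ ((λ ()) ∷ [])
  ∷ [] ∷ []) i j

many-valencies : ∀ w → Realisable (3 ℕ.+ w)
many-valencies w = _ , G ,
  blockGraph-connected mem zero (λ k → inhabited (List.lookup blocks k) (block-size k)) ,
  -- Block 0 is `⊤`, so it forms a triangle with the points 0 and 1.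
  blockGraph-nonbipartite mem {0F} {1F} {0F} (λ ()) refl refl ,
  exactly-spectrum (cliqueWithBlocks mem) (blockGraph-sym mem) (blockGraph-irrefl mem) θ θ-injective
    (spectrum-eigenvectors mem d l design twins t₁ t₂ a₁ a₂ t-sum t-product a-sum a-product θ-injective)
    (BlockGraph.Roots.annihilates mem d l design t₁ t₂ a₁ a₂ t-sum t-product a-sum a-product) ,
  size , (λ {i} {j} → size-injective i j) , attained , λ { _ (i , refl) → covered i }
  where
  open Design w
  G = blockGraph mem
  open Graph G using (degree)

  t₁ t₂ a₁ a₂ : ℤ
  t₁ = + m
  t₂ = -[1+ m ]
  a₁ = + (m ℕ.+ (v ℕ.+ v))
  a₂ = -[1+ (m ℕ.+ v) ]

  θ : Fin 5 → ℤ
  θ = spectrum t₁ t₂ a₁ a₂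

  0<m : 0 < m
  0<m = ℕ.m^n>0 2 w

  θ-injective : Injective _≡_ _≡_ θ
  θ-injective = spectrum-unique 0<m (ℕ.m<m+n m (s≤s z≤n)) (ℕ.m<m+n m (s≤s z≤n))

  M V : ℤ
  M = + m
  V = + v

  open ℤSolver.+-*-Solver
  +d : + d ≡ M ℤ.+ M ℤ.* M
  +d = cong (λ x → M ℤ.+ x) (ℤ.pos-* m m)

  +l : + l ≡ + 2 ℤ.+ (+ 3 ℤ.* M ℤ.+ + 2 ℤ.* V)
  +l = cong₂ (λ x y → + 2 ℤ.+ (x ℤ.+ y)) (ℤ.pos-* 3 m) (ℤ.pos-* 2 v)

  t-sum : t₁ ℤ.+ t₂ ≡ -1ℤ
  t-sum = solve 1 (λ m → m :+ (:- (con 1ℤ :+ m)) := con -1ℤ) refl M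

  t-product : t₁ ℤ.* t₂ ≡ ℤ.- (+ d)
  t-product = trans
    (solve 1 (λ m → m :* (:- (con 1ℤ :+ m)) := :- (m :+ m :* m)) refl M)
    (cong ℤ.-_ (sym +d))

  a-sum : a₁ ℤ.+ a₂ ℤ.+ 1ℤ ≡ + v
  a-sum = solve 2 (λ m v → (m :+ (v :+ v)) :+ (:- (con 1ℤ :+ (m :+ v))) :+ con 1ℤ := v) refl M V

  a-product : a₁ ℤ.* a₂ ≡ ℤ.- (+ d ℤ.+ + v ℤ.* + l)
  a-product = trans
    (solve 2 (λ m v → (m :+ (v :+ v)) :* (:- (con 1ℤ :+ (m :+ v)))
       := :- ((m :+ m :* m) :+ v :* (con (+ 2) :+ (con (+ 3) :* m :+ con (+ 2) :* v)))) refl M V)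
    (sym (cong₂ (λ x y → ℤ.- (x ℤ.+ V ℤ.* y)) +d +l))

  -- A point has `v - 1` neighbours in the clique and lies in `r` blocks, where `r = d + l` is the
  -- diagonal case of `design`.
  point-degree : ∀ i → degree (i ↑ˡ (2 ℕ.+ b)) ≡ suc w ℕ.+ (d ℕ.+ l)
  point-degree i = trans (degree-point mem i) (cong₂ ℕ._+_ (sum-others i) (begin
    ℕΣ.sum (λ k → 𝟙ℕ (mem k i))
      ≡⟨ ℕΣ.sum-cong-≗ (λ k → cong 𝟙ℕ (sym (Bool.∧-idem (mem k i)))) ⟩
    ℕΣ.sum (λ k → 𝟙ℕ (mem k i ∧ mem k i))
      ≡⟨ design i i ⟩
    (if does (i Fin.≟ i) then d else 0) ℕ.+ l
      ≡⟨ cong (λ q → (if q then d else 0) ℕ.+ l) (dec-true (i Fin.≟ i) refl) ⟩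
    d ℕ.+ l ∎))
    where open ≡-Reasoning

  block-degree : ∀ k → degree (v ↑ʳ k) ≡ card (List.lookup blocks k)
  block-degree k = trans (degree-block mem k) (sum≡card (List.lookup blocks k))

  -- Index `zero` is the common valency of the points; the other `2 + w` indices are the block sizes
  -- from 1 to `v`.
  size : Fin (3 ℕ.+ w) → ℕ
  size zero    = suc w ℕ.+ (d ℕ.+ l)
  size (suc a) = suc (toℕ a)

  large : ∀ a → size (suc a) < size zero
  large a = ℕ.<-≤-trans (s≤s (Fin.toℕ<n a)) (begin
    2 ℕ.+ suc w               ≡⟨ ℕ.+-comm 2 (suc w) ⟩
    -- The summand 2 in `l` alone lifts the point valency above `v`.
    suc w ℕ.+ 2               ≤⟨ ℕ.+-monoʳ-≤ (suc w) (ℕ.≤-trans (ℕ.m≤m+n 2 _) (ℕ.m≤n+m l d)) ⟩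
    suc w ℕ.+ (d ℕ.+ l)       ∎)
    where open ℕ.≤-Reasoning

  size-injective : ∀ i j → size i ≡ size j → i ≡ j
  size-injective zero    zero    _  = refl
  size-injective zero    (suc a) eq = contradiction (sym eq) (ℕ.<⇒≢ (large a))
  size-injective (suc a) zero    eq = contradiction eq (ℕ.<⇒≢ (large a))
  size-injective (suc a) (suc c) eq = cong suc (Fin.toℕ-injective (ℕ.suc-injective eq))

  attained : ∀ i → Graph.IsValency G (size i)
  attained zero    = zero {suc w} ↑ˡ (2 ℕ.+ b) , point-degree zero
  attained (suc a) = let k , size≡ = block-of-size a in v ↑ʳ k , trans (block-degree k) size≡

  size-of-block : ∀ s → 1 ≤ s → s ≤ v → ∃[ i ] s ≡ size i
  size-of-block (suc s) _ s<v = suc (fromℕ< s<v) , cong suc (sym (Fin.toℕ-fromℕ< s<v))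

  covered : ∀ i → ∃[ a ] degree i ≡ size a
  covered = splitAt-elim v (λ i → ∃[ a ] degree i ≡ size a)
    (λ i → zero , point-degree i)
    (λ k → let a , eq = size-of-block (card (List.lookup blocks k)) (block-size k) (∣p∣≤n (List.lookup blocks k))
           in a , trans (block-degree k) eq)

theorem3 : ∀ (t : ℕ) → t ≥ 1 →
    ∃[ n ] Σ[ G ∈ Graph n ]
    Graph.Connected G
    × ¬ Graph.Bipartite G
    × Exactly 5 _≈_ (IsEigenvalue (Graph.adjacencyMatrix G))
    × Exactly t _≡_ (Graph.IsValency G)
theorem3 1 _ = one-valency
theorem3 2 _ = two-valencies
theorem3 (suc (suc (suc w))) _ = many-valencies w
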